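{- Let $w$ be an infinite recurrent binary word (over $\Sigma=\{0,1\}$, containing both letters) generated by a morphism $\phi$. Then $w$ satisfies the WELLDOC property if and only if $\det A_\phi = \pm 1$.
   Context: A morphism $\phi:\Sigma^*\to\Sigma^*$ is nonerasing; an infinite word $w$ is generated by $\phi$ if $\phi(a)=as$ for a letter $a$ and a nonempty word $s$, and $w=\lim_{n\to\infty}\phi^n(a)$ (limit in the prefix sense). The matrix $A_\phi$ is the $\sigma\times\sigma$ integer matrix ($\sigma=|\Sigma|$) whose entry in row $j$, column $i$ is $|\phi(i)|_j$, the number of occurrences of letter $j$ in $\phi(i)$. The Parikh vector of a finite word $u$ is $V_u=(|u|_0,\dots,|u|_{\sigma-1})$. For a factor $u$ of $w$ occurring at positions $a_0,a_1,\dots$, let $X_u=\{V_{w[0,a_i)}: i\ge 0\}$ (Parikh vectors of the prefixes preceding occurrences of $u$) and $X_{u,m}$ the set of these vectors reduced modulo $m$. The word $w$ satisfies WELLDOC if $X_{u,m}=(\mathbb{Z}/m\mathbb{Z})^\sigma$ for every integer $m\ge1$ and every factor $u$ of $w$. A word is recurrent if each of its factors occurs infinitely often. By convention, a binary word contains both letters $0$ and $1$. -}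

module Defs where

open import Data.Nat using (ℕ; zero; suc; _+_; _*_; _<_; _≤_; _%_)
import Data.Fin
open import Data.Fin using (Fin; fromℕ<) renaming (_≟_ to _≟ᶠ_)
open import Data.List using (List; []; _∷_; length; lookup; concatMap)
open import Data.Integer using (ℤ; +_; -_) renaming (_-_ to _-ℤ_; _*_ to _*ℤ_)
open import Data.Product using (Σ; ∃; ∃-syntax; _×_; _,_)
open import Relation.Binary.PropositionalEquality using (_≡_; _≢_)
open import Relation.Nullary using (yes; no)
open import Data.Sum using (_⊎_)

Letter : Set
Letter = Fin 2

l0 : Letter
l0 = Data.Fin.zero

l1 : Letter
l1 = Data.Fin.suc Data.Fin.zero

Morphism : Set
Morphism = Letter → List Letter

InfWord : Set
InfWord = ℕ → Letter

applyM : Morphism → List Letter → List Letter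
applyM φ u = concatMap φ u

iterM : Morphism → ℕ → List Letter → List Letter
iterM φ zero    u = u
iterM φ (suc n) u = applyM φ (iterM φ n u)

Nonerasing : Morphism → Set
Nonerasing φ = ∀ (c : Letter) → 0 < length (φ c)

IsPrefix : List Letter → InfWord → Set
IsPrefix u w = ∀ (k : ℕ) (h : k < length u) → lookup u (fromℕ< h) ≡ w k

-- w is generated by φ: φ(a) = a s with s nonempty, and w = lim φ^n(a)
-- (every φ^n(a) is a prefix of w; since |φ^n(a)| → ∞ this determines w)
GeneratedBy : Morphism → InfWord → Set
GeneratedBy φ w =
  Σ Letter λ a → Σ (List Letter) λ s →
    (φ a ≡ a ∷ s) × (s ≢ []) × (∀ (n : ℕ) → IsPrefix (iterM φ n (a ∷ [])) w)

OccursAt : InfWord → ℕ → ℕ → ℕ → Set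
OccursAt w i n p = ∀ (k : ℕ) → k < n → w (p + k) ≡ w (i + k)

Recurrent : InfWord → Set
Recurrent w = ∀ (i n N : ℕ) → ∃[ p ] (N ≤ p × OccursAt w i n p)

ContainsBoth : InfWord → Set
ContainsBoth w = (∃[ i ] w i ≡ l0) × (∃[ j ] w j ≡ l1)

countL : Letter → List Letter → ℕ
countL c [] = 0
countL c (x ∷ u) with x ≟ᶠ c
... | yes _ = suc (countL c u)
... | no  _ = countL c u

countPrefix : Letter → InfWord → ℕ → ℕ
countPrefix c w zero    = 0
countPrefix c w (suc p) with w p ≟ᶠ c
... | yes _ = suc (countPrefix c w p)
... | no  _ = countPrefix c w p

-- WELLDOC: for every m ≥ 1 (m = suc k), every factor u = w[i,i+n) and every
-- (x₀,x₁) ∈ (ℤ/mℤ)², some occurrence of u at position p has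
-- V_{w[0,p)} ≡ (x₀,x₁) mod m.
WELLDOC : InfWord → Set
WELLDOC w =
  ∀ (k i n x₀ x₁ : ℕ) → x₀ < suc k → x₁ < suc k →
    ∃[ p ] (OccursAt w i n p
           × countPrefix l0 w p % suc k ≡ x₀
           × countPrefix l1 w p % suc k ≡ x₁)

-- entry (row j, column i) of A_φ : |φ(i)|_j
matA : Morphism → Letter → Letter → ℕ
matA φ j i = countL j (φ i)

detA : Morphism → ℤ
detA φ = (+ matA φ l0 l0 *ℤ + matA φ l1 l1) -ℤ (+ matA φ l0 l1 *ℤ + matA φ l1 l0)

{-# OPTIONS --safe #-}
-- Let w = φ(w) be cut into the blocks φ(wⱼ). Then V(prefix before block j) = A V(prefix of length j).
--
-- If det A = ±1: let a = w₀ and let H be the set of residues mod m of Parikh vectors of prefixes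
-- followed by a. As A has finite order mod m and every prefix of w recurs at the image under φⁿ of any
-- a, H is a subgroup, invariant under A. Looking at aa, bb, ab and ba in w shows that H is everything,
-- and then so is the corresponding set for any factor, since it contains a translate of Aⁿ H.
--
-- If some m ≥ 2 divides det A: a linear functional f that is nonzero mod m satisfies f A = 0 mod m, so
-- f is constant mod m on the prefixes ending at block boundaries. After conjugating φ so that its two
-- images start with different letters, the parse into blocks is read off by a deterministic finite
-- automaton. By WELLDOC any factor also ends strictly inside a block in some occurrence; extending it to
-- a right special factor, one of its two continuations kills the state of that occurrence, so the set
-- of possible states shrinks again and again, which is impossible.

module Submission where

open import Defs
open import Data.Nat as ℕ using (ℕ; zero; suc; _≤_; _<_; z≤n; s≤s; _%_)
import Data.Nat.Properties as ℕ
import Data.Nat.DivMod as ℕ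
import Data.Nat.Divisibility as ℕ
import Data.Nat.Tactic.RingSolver as ℕ-Solver
open import Data.Fin using (Fin; zero; suc; fromℕ<; combine; toℕ) renaming (_≟_ to _≟ᶠ_)
import Data.Fin.Properties as Fin
open import Data.Integer using (ℤ; +_; -_; _+_; _*_; _-_; 0ℤ; 1ℤ)
import Data.Integer as ℤ using (∣_∣)
import Data.Integer.Properties as ℤ
import Data.Integer.DivMod as ℤ
open import Data.Integer.Divisibility.Signed
open import Data.Integer.Tactic.RingSolver using (solve-∀)
open import Data.List using (List; []; _∷_; _++_; length; lookup; map; mapMaybe)
import Data.List.Properties as List
open import Data.List.Membership.Propositional using (_∈_)
open import Data.List.Membership.Propositional.Properties using (∈-++⁺ˡ; ∈-++⁺ʳ; ∈-map⁺)
open import Data.List.Relation.Unary.Any using (here; there)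
open import Data.Maybe using (Maybe; just; nothing)
open import Data.Product using (∃-syntax; ∃₂; _×_; _,_; proj₁; proj₂)
open import Data.Sum using (_⊎_; inj₁; inj₂)
open import Data.Empty using (⊥; ⊥-elim)
open import Data.Unit using (⊤; tt)
open import Function using (_∘_; case_of_)
open import Function.Bundles using (_⇔_; mk⇔)
open import Relation.Binary.PropositionalEquality
open import Relation.Nullary using (¬_; Dec; yes; no)

-- Finite words read inside an infinite word, occurrences, and letter counts.

Reads : InfWord → ℕ → List Letter → Set
Reads w p []      = ⊤
Reads w p (x ∷ u) = w p ≡ x × Reads w (suc p) u

reads-++⁻ : ∀ w u {v p} → Reads w p (u ++ v) → Reads w p u × Reads w (p ℕ.+ length u) v
reads-++⁻ w []      {v} {p} r = tt , subst (λ p → Reads w p v) (sym (ℕ.+-identityʳ p)) r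
reads-++⁻ w (x ∷ u) {v} {p} (e , r) with reads-++⁻ w u r
... | r₁ , r₂ = (e , r₁) , subst (λ p → Reads w p v) (sym (ℕ.+-suc p (length u))) r₂

reads-++⁺ : ∀ w u {v p} → Reads w p u → Reads w (p ℕ.+ length u) v → Reads w p (u ++ v)
reads-++⁺ w []      {v} {p} _       s = subst (λ p → Reads w p v) (ℕ.+-identityʳ p) s
reads-++⁺ w (x ∷ u) {v} {p} (e , r) s =
  e , reads-++⁺ w u r (subst (λ p → Reads w p v) (ℕ.+-suc p (length u)) s)

lookup⇒reads : ∀ w u p → (∀ k (h : k < length u) → lookup u (fromℕ< h) ≡ w (p ℕ.+ k)) → Reads w p u
lookup⇒reads w []      p f = tt
lookup⇒reads w (x ∷ u) p f =
  trans (cong w (sym (ℕ.+-identityʳ p))) (sym (f 0 (s≤s z≤n))) ,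
  lookup⇒reads w u (suc p) λ k h → trans (f (suc k) (s≤s h)) (cong w (ℕ.+-suc p k))

occurs-≤ : ∀ {w i n k p} → k ≤ n → OccursAt w i n p → OccursAt w i k p
occurs-≤ k≤n o j j<k = o j (ℕ.≤-trans j<k k≤n)

occurs-++ : ∀ {w i n k p} → OccursAt w i n p → OccursAt w (i ℕ.+ n) k (p ℕ.+ n) →
            OccursAt w i (n ℕ.+ k) p
occurs-++ {w} {i} {n} {k} {p} o₁ o₂ j j<n+k with j ℕ.<? n
... | yes j<n = o₁ j j<n
... | no  j≮n = begin
  w (p ℕ.+ j)                 ≡⟨ cong (λ j → w (p ℕ.+ j)) (sym n+d≡j) ⟩
  w (p ℕ.+ (n ℕ.+ d))         ≡⟨ cong w (sym (ℕ.+-assoc p n d)) ⟩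
  w (p ℕ.+ n ℕ.+ d)           ≡⟨ o₂ d (ℕ.+-cancelˡ-< n d k (subst (_< n ℕ.+ k) (sym n+d≡j) j<n+k)) ⟩
  w (i ℕ.+ n ℕ.+ d)           ≡⟨ cong w (ℕ.+-assoc i n d) ⟩
  w (i ℕ.+ (n ℕ.+ d))         ≡⟨ cong (λ j → w (i ℕ.+ j)) n+d≡j ⟩
  w (i ℕ.+ j)                 ∎
  where
  open ≡-Reasoning
  d = j ℕ.∸ n
  n+d≡j : n ℕ.+ d ≡ j
  n+d≡j = ℕ.m+[n∸m]≡n (ℕ.≮⇒≥ j≮n)

reads⇒occurs : ∀ {w} u {p q} → Reads w p u → Reads w q u → OccursAt w q (length u) p
reads⇒occurs []      _ _ k ()
reads⇒occurs {w} (x ∷ u) {p} {q} (e , _) (e′ , _) zero _ =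
  trans (trans (cong w (ℕ.+-identityʳ p)) e) (sym (trans (cong w (ℕ.+-identityʳ q)) e′))
reads⇒occurs {w} (x ∷ u) {p} {q} (_ , r) (_ , r′) (suc k) (s≤s k<n) =
  trans (cong w (ℕ.+-suc p k))
    (trans (reads⇒occurs u r r′ k k<n) (cong w (sym (ℕ.+-suc q k))))

δ : Letter → Letter → ℕ
δ c x = countL c (x ∷ [])

countL-∷ : ∀ c x u → countL c (x ∷ u) ≡ δ c x ℕ.+ countL c u
countL-∷ c x u with x ≟ᶠ c
... | yes _ = refl
... | no  _ = refl

countPrefix-suc : ∀ c w p → countPrefix c w (suc p) ≡ countPrefix c w p ℕ.+ δ c (w p)
countPrefix-suc c w p with w p ≟ᶠ c
... | yes _ = sym (ℕ.+-comm (countPrefix c w p) 1)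
... | no  _ = sym (ℕ.+-identityʳ _)

countL-++ : ∀ c u v → countL c (u ++ v) ≡ countL c u ℕ.+ countL c v
countL-++ c []      v = refl
countL-++ c (x ∷ u) v = begin
  countL c (x ∷ u ++ v)                    ≡⟨ countL-∷ c x (u ++ v) ⟩
  δ c x ℕ.+ countL c (u ++ v)              ≡⟨ cong (δ c x ℕ.+_) (countL-++ c u v) ⟩
  δ c x ℕ.+ (countL c u ℕ.+ countL c v)    ≡⟨ sym (ℕ.+-assoc (δ c x) _ _) ⟩
  δ c x ℕ.+ countL c u ℕ.+ countL c v      ≡⟨ cong (ℕ._+ countL c v) (sym (countL-∷ c x u)) ⟩
  countL c (x ∷ u) ℕ.+ countL c v          ∎
  where open ≡-Reasoning

countPrefix-reads : ∀ c w u p → Reads w p u →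
                    countPrefix c w (p ℕ.+ length u) ≡ countPrefix c w p ℕ.+ countL c u
countPrefix-reads c w []      p _ =
  trans (cong (countPrefix c w) (ℕ.+-identityʳ p)) (sym (ℕ.+-identityʳ _))
countPrefix-reads c w (x ∷ u) p (refl , r) = begin
  countPrefix c w (p ℕ.+ suc (length u))           ≡⟨ cong (countPrefix c w) (ℕ.+-suc p _) ⟩
  countPrefix c w (suc p ℕ.+ length u)             ≡⟨ countPrefix-reads c w u (suc p) r ⟩
  countPrefix c w (suc p) ℕ.+ countL c u           ≡⟨ cong (ℕ._+ countL c u) (countPrefix-suc c w p) ⟩
  countPrefix c w p ℕ.+ δ c x ℕ.+ countL c u       ≡⟨ ℕ.+-assoc (countPrefix c w p) _ _ ⟩
  countPrefix c w p ℕ.+ (δ c x ℕ.+ countL c u)     ≡⟨ cong (countPrefix c w p ℕ.+_) (sym (countL-∷ c x u)) ⟩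
  countPrefix c w p ℕ.+ countL c (x ∷ u)           ∎
  where open ≡-Reasoning

shift : ℕ → InfWord → InfWord
shift i w k = w (i ℕ.+ k)

countPrefix-+ : ∀ c w i n → countPrefix c w (i ℕ.+ n) ≡ countPrefix c w i ℕ.+ countPrefix c (shift i w) n
countPrefix-+ c w i zero    = trans (cong (countPrefix c w) (ℕ.+-identityʳ i)) (sym (ℕ.+-identityʳ _))
countPrefix-+ c w i (suc n) = begin
  countPrefix c w (i ℕ.+ suc n)                                        ≡⟨ cong (countPrefix c w) (ℕ.+-suc i n) ⟩
  countPrefix c w (suc (i ℕ.+ n))                                      ≡⟨ countPrefix-suc c w (i ℕ.+ n) ⟩
  countPrefix c w (i ℕ.+ n) ℕ.+ d                                      ≡⟨ cong (ℕ._+ d) (countPrefix-+ c w i n) ⟩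
  countPrefix c w i ℕ.+ countPrefix c (shift i w) n ℕ.+ d              ≡⟨ ℕ.+-assoc (countPrefix c w i) _ d ⟩
  countPrefix c w i ℕ.+ (countPrefix c (shift i w) n ℕ.+ d)            ≡⟨ cong (countPrefix c w i ℕ.+_) (sym (countPrefix-suc c (shift i w) n)) ⟩
  countPrefix c w i ℕ.+ countPrefix c (shift i w) (suc n)              ∎
  where
  open ≡-Reasoning
  d = δ c (w (i ℕ.+ n))

countPrefix-cong : ∀ c {v w} n → (∀ k → k < n → v k ≡ w k) → countPrefix c v n ≡ countPrefix c w n
countPrefix-cong c {v} {w} zero    _ = refl
countPrefix-cong c {v} {w} (suc n) e = begin
  countPrefix c v (suc n)             ≡⟨ countPrefix-suc c v n ⟩
  countPrefix c v n ℕ.+ δ c (v n)     ≡⟨ cong₂ (λ x y → x ℕ.+ δ c y) (countPrefix-cong c n λ k k<n → e k (ℕ.m≤n⇒m≤1+n k<n)) (e n ℕ.≤-refl) ⟩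
  countPrefix c w n ℕ.+ δ c (w n)     ≡⟨ sym (countPrefix-suc c w n) ⟩
  countPrefix c w (suc n)             ∎
  where open ≡-Reasoning

countPrefix-≤ : ∀ c w {m n} → m ≤ n → countPrefix c w m ≤ countPrefix c w n
countPrefix-≤ c w {m} {n} m≤n =
  subst (λ n → countPrefix c w m ≤ countPrefix c w n) (ℕ.m+[n∸m]≡n m≤n)
    (subst (countPrefix c w m ≤_) (sym (countPrefix-+ c w m (n ℕ.∸ m))) (ℕ.m≤m+n _ _))

δ-sum : ∀ x → δ l0 x ℕ.+ δ l1 x ≡ 1
δ-sum zero       = refl
δ-sum (suc zero) = refl

δ-refl : ∀ x → δ x x ≡ 1
δ-refl zero       = refl
δ-refl (suc zero) = refl

countPrefix-sum : ∀ w n → countPrefix l0 w n ℕ.+ countPrefix l1 w n ≡ n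
countPrefix-sum w zero    = refl
countPrefix-sum w (suc n) = begin
  countPrefix l0 w (suc n) ℕ.+ countPrefix l1 w (suc n)
    ≡⟨ cong₂ ℕ._+_ (countPrefix-suc l0 w n) (countPrefix-suc l1 w n) ⟩
  countPrefix l0 w n ℕ.+ δ l0 (w n) ℕ.+ (countPrefix l1 w n ℕ.+ δ l1 (w n))
    ≡⟨ interchange (countPrefix l0 w n) (δ l0 (w n)) (countPrefix l1 w n) (δ l1 (w n)) ⟩
  countPrefix l0 w n ℕ.+ countPrefix l1 w n ℕ.+ (δ l0 (w n) ℕ.+ δ l1 (w n))
    ≡⟨ cong₂ ℕ._+_ (countPrefix-sum w n) (δ-sum (w n)) ⟩
  n ℕ.+ 1
    ≡⟨ ℕ.+-comm n 1 ⟩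
  suc n ∎
  where
  open ≡-Reasoning
  interchange : ∀ a b c d → a ℕ.+ b ℕ.+ (c ℕ.+ d) ≡ a ℕ.+ c ℕ.+ (b ℕ.+ d)
  interchange = ℕ-Solver.solve-∀

-- The cutting of w = φ(w) into blocks.

blockEnd : Morphism → InfWord → ℕ → ℕ
blockEnd φ w zero    = 0
blockEnd φ w (suc j) = blockEnd φ w j ℕ.+ length (φ (w j))

-- The equation w = φ(w), block by block: block j, counted from 0, starts at `blockEnd φ w j`, where
-- the first j blocks end.
FixedBy : Morphism → InfWord → Set
FixedBy φ w = ∀ j → Reads w (blockEnd φ w j) (φ (w j))

reads-blocks : ∀ φ w u i → Reads w i u → Reads w (blockEnd φ w i) (applyM φ u) →
               ∀ r → r < length u → Reads w (blockEnd φ w (i ℕ.+ r)) (φ (w (i ℕ.+ r)))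
reads-blocks φ w (x ∷ u) i (refl , ru) rφ zero    _ rewrite ℕ.+-identityʳ i = proj₁ (reads-++⁻ w (φ (w i)) rφ)
reads-blocks φ w (x ∷ u) i (refl , ru) rφ (suc r) (s≤s r<n) rewrite ℕ.+-suc i r =
  reads-blocks φ w u (suc i) ru (proj₂ (reads-++⁻ w (φ (w i)) rφ)) r r<n

length-applyM : ∀ φ → Nonerasing φ → ∀ u → length u ≤ length (applyM φ u)
length-applyM φ ne []      = z≤n
length-applyM φ ne (x ∷ u) =
  subst (suc (length u) ≤_) (sym (List.length-++ (φ x))) (ℕ.+-mono-≤ (ne x) (length-applyM φ ne u))

length-nonempty : ∀ {s : List Letter} → s ≢ [] → 0 < length s
length-nonempty {[]}    s≢[] = ⊥-elim (s≢[] refl)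
length-nonempty {_ ∷ _} _    = s≤s z≤n

-- Each application turns the leading a into a s and, φ being nonerasing, does not shorten the rest,
-- so at least one letter is gained.
iterM-grows : ∀ φ → Nonerasing φ → ∀ {a s} → φ a ≡ a ∷ s → s ≢ [] → ∀ n →
              ∃[ t ] (iterM φ n (a ∷ []) ≡ a ∷ t × n ≤ length t)
iterM-grows φ ne             eq s≢[] zero    = [] , refl , z≤n
iterM-grows φ ne {a} {s} eq s≢[] (suc n) with iterM-grows φ ne eq s≢[] n
... | t , it≡ , n≤t =
  s ++ applyM φ t ,
  trans (cong (applyM φ) it≡) (cong (_++ applyM φ t) eq) ,
  subst (suc n ≤_) (sym (List.length-++ s))
    (ℕ.+-mono-≤ (length-nonempty s≢[]) (ℕ.≤-trans n≤t (length-applyM φ ne t)))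

-- Two consecutive iterates suffice for block j: φ^j(a) is a prefix of w longer than j, and its
-- image φ^(j+1)(a), again a prefix, contains that block.
generated⇒fixed : ∀ φ w → Nonerasing φ → GeneratedBy φ w → FixedBy φ w
generated⇒fixed φ w ne (a , s , eq , s≢[] , pre) j with iterM-grows φ ne eq s≢[] j
... | t , it≡ , j≤t =
  reads-blocks φ w (iterM φ j (a ∷ [])) 0 (lookup⇒reads w _ 0 (pre j)) (lookup⇒reads w _ 0 (pre (suc j))) j
    (subst (λ u → j < length u) (sym it≡) (s≤s j≤t))

countPrefix-blockEnd : ∀ φ w → FixedBy φ w → ∀ c j → countPrefix c w (blockEnd φ w j) ≡
                       matA φ c l0 ℕ.* countPrefix l0 w j ℕ.+ matA φ c l1 ℕ.* countPrefix l1 w j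
countPrefix-blockEnd φ w fix c zero    = zeros (matA φ c l0) (matA φ c l1)
  where
  zeros : ∀ p q → 0 ≡ p ℕ.* 0 ℕ.+ q ℕ.* 0
  zeros = ℕ-Solver.solve-∀
countPrefix-blockEnd φ w fix c (suc j) = begin
  countPrefix c w (blockEnd φ w j ℕ.+ length (φ (w j)))
    ≡⟨ countPrefix-reads c w (φ (w j)) _ (fix j) ⟩
  countPrefix c w (blockEnd φ w j) ℕ.+ matA φ c (w j)
    ≡⟨ cong (ℕ._+ matA φ c (w j)) (countPrefix-blockEnd φ w fix c j) ⟩
  p ℕ.* x ℕ.+ q ℕ.* y ℕ.+ matA φ c (w j)
    ≡⟨ cong (p ℕ.* x ℕ.+ q ℕ.* y ℕ.+_) (column (w j)) ⟩
  p ℕ.* x ℕ.+ q ℕ.* y ℕ.+ (p ℕ.* δ l0 (w j) ℕ.+ q ℕ.* δ l1 (w j))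
    ≡⟨ regroup p q x y (δ l0 (w j)) (δ l1 (w j)) ⟩
  p ℕ.* (x ℕ.+ δ l0 (w j)) ℕ.+ q ℕ.* (y ℕ.+ δ l1 (w j))
    ≡⟨ sym (cong₂ (λ x y → p ℕ.* x ℕ.+ q ℕ.* y) (countPrefix-suc l0 w j) (countPrefix-suc l1 w j)) ⟩
  p ℕ.* countPrefix l0 w (suc j) ℕ.+ q ℕ.* countPrefix l1 w (suc j) ∎
  where
  open ≡-Reasoning
  p = matA φ c l0
  q = matA φ c l1
  x = countPrefix l0 w j
  y = countPrefix l1 w j
  fst : ∀ p q → p ≡ p ℕ.* 1 ℕ.+ q ℕ.* 0
  fst = ℕ-Solver.solve-∀
  snd : ∀ p q → q ≡ p ℕ.* 0 ℕ.+ q ℕ.* 1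
  snd = ℕ-Solver.solve-∀
  column : ∀ d → matA φ c d ≡ p ℕ.* δ l0 d ℕ.+ q ℕ.* δ l1 d
  column zero       = fst p q
  column (suc zero) = snd p q
  regroup : ∀ p q x y d e → p ℕ.* x ℕ.+ q ℕ.* y ℕ.+ (p ℕ.* d ℕ.+ q ℕ.* e) ≡ p ℕ.* (x ℕ.+ d) ℕ.+ q ℕ.* (y ℕ.+ e)
  regroup = ℕ-Solver.solve-∀

-- Integer counts and congruences.

count : Letter → InfWord → ℕ → ℤ
count c w n = + countPrefix c w n

%ℕ≡⇒∣ : ∀ m .{{_ : ℕ.NonZero m}} x y → x ℤ.%ℕ m ≡ y ℤ.%ℕ m → + m ∣ x - y
%ℕ≡⇒∣ m x y e = divides (qx - qy) (begin
  x - y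
    ≡⟨ cong₂ _-_ (ℤ.a≡a%ℕn+[a/ℕn]*n x m) (ℤ.a≡a%ℕn+[a/ℕn]*n y m) ⟩
  (+ (x ℤ.%ℕ m) + qx * + m) - (+ (y ℤ.%ℕ m) + qy * + m)
    ≡⟨ cong (λ r → (+ r + qx * + m) - (+ (y ℤ.%ℕ m) + qy * + m)) e ⟩
  (+ (y ℤ.%ℕ m) + qx * + m) - (+ (y ℤ.%ℕ m) + qy * + m)
    ≡⟨ cancel (+ (y ℤ.%ℕ m)) qx qy (+ m) ⟩
  (qx - qy) * + m ∎)
  where
  open ≡-Reasoning
  qx = x ℤ./ℕ m
  qy = y ℤ./ℕ m
  cancel : ∀ r a b n → (r + a * n) - (r + b * n) ≡ (a - b) * n
  cancel = solve-∀

-- |a - b| is at most max(a, b) < m, so being a multiple of m it is zero.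
∣-∧<⇒≡ : ∀ {m a b} → a < m → b < m → + m ∣ + a - + b → a ≡ b
∣-∧<⇒≡ {m} {a} {b} a<m b<m m∣ with ℤ.∣ + a - + b ∣ in eq
... | zero  = ℤ.+-injective (ℤ.i-j≡0⇒i≡j (+ a) (+ b) (ℤ.∣i∣≡0⇒i≡0 eq))
... | suc d = ⊥-elim (ℕ.<⇒≱ (ℕ.≤-<-trans bound (ℕ.⊔-lub a<m b<m)) (ℕ.∣⇒≤ (subst (m ℕ.∣_) eq (∣⇒∣ᵤ m∣))))
  where
  bound : suc d ≤ a ℕ.⊔ b
  bound = subst (_≤ a ℕ.⊔ b) (trans (cong ℤ.∣_∣ (sym (ℤ.m-n≡m⊖n a b))) eq) (ℤ.∣m⊝n∣≤m⊔n a b)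

∣⇒%≡ : ∀ k n {x} → x < suc k → + suc k ∣ + n - + x → n % suc k ≡ x
∣⇒%≡ k n {x} x<m m∣ = ∣-∧<⇒≡ (ℕ.m%n<n n (suc k)) x<m
  (subst (+ suc k ∣_) (telescope (+ (n % suc k)) (+ n) (+ x))
    (∣m∣n⇒∣m+n (%ℕ≡⇒∣ (suc k) (+ (n % suc k)) (+ n) (ℕ.m%n%n≡m%n n (suc k))) m∣))
  where
  telescope : ∀ a b c → (a - b) + (b - c) ≡ a - c
  telescope = solve-∀

-- WELLDOC with arbitrary integer targets, so that later arguments work with congruences instead of
-- remainders.
welldoc-ℤ : ∀ {w} → WELLDOC w → ∀ k i n x y →
            ∃[ p ] (OccursAt w i n p × + suc k ∣ count l0 w p - x × + suc k ∣ count l1 w p - y)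
welldoc-ℤ {w} wd k i n x y
  with wd k i n (x ℤ.%ℕ suc k) (y ℤ.%ℕ suc k) (ℤ.n%ℕd<d x (suc k)) (ℤ.n%ℕd<d y (suc k))
... | p , occ , ex , ey = p , occ , %ℕ≡⇒∣ (suc k) (count l0 w p) x ex , %ℕ≡⇒∣ (suc k) (count l1 w p) y ey

-- Periods, and the existence of right special extensions.

Period : InfWord → ℕ → Set
Period v n = ∀ k → v (n ℕ.+ k) ≡ v k

countPrefix-*-period : ∀ c v {q} → Period v q → ∀ n → countPrefix c v (n ℕ.* q) ≡ n ℕ.* countPrefix c v q
countPrefix-*-period c v         per zero    = refl
countPrefix-*-period c v {q} per (suc n) = begin
  countPrefix c v (q ℕ.+ n ℕ.* q)                               ≡⟨ countPrefix-+ c v q (n ℕ.* q) ⟩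
  countPrefix c v q ℕ.+ countPrefix c (shift q v) (n ℕ.* q)     ≡⟨ cong (countPrefix c v q ℕ.+_) (countPrefix-cong c (n ℕ.* q) λ k _ → per k) ⟩
  countPrefix c v q ℕ.+ countPrefix c v (n ℕ.* q)               ≡⟨ cong (countPrefix c v q ℕ.+_) (countPrefix-*-period c v per n) ⟩
  countPrefix c v q ℕ.+ n ℕ.* countPrefix c v q                 ∎
  where open ≡-Reasoning

-- Both sides count the letter c in the prefix of length p q.
period-proportional : ∀ c v {p q} → Period v p → Period v q → p ℕ.* countPrefix c v q ≡ q ℕ.* countPrefix c v p
period-proportional c v {p} {q} perp perq =
  trans (sym (countPrefix-*-period c v perq p))
    (trans (cong (countPrefix c v) (ℕ.*-comm p q)) (countPrefix-*-period c v perp q))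

-- If a factor determined its whole future T, then T would have a period P, and P·|u|₀ − a·|u|
-- (with a the number of zeros in a period) would be the same for all prefixes u preceding it.
rightSpecial : ∀ {w} → WELLDOC w → Recurrent w → ∀ i n →
               ¬ (∀ s p → OccursAt w i (n ℕ.+ s) p → w (p ℕ.+ (n ℕ.+ s)) ≡ w (i ℕ.+ (n ℕ.+ s)))
rightSpecial {w} wd rec i n forced with rec i n (suc i)
... | p₀ , i<p₀ , occ₀ = ℕ.<⇒≱ ℕ.≤-refl (ℕ.∣⇒≤ {{ℕ.>-nonZero 0<P}} (∣⇒∣ᵤ P∣))
  where
  T : InfWord
  T = shift i w

  Future : ℕ → Set
  Future p = ∀ k → w (p ℕ.+ k) ≡ T k

  extend : ∀ p → OccursAt w i n p → ∀ s → OccursAt w i (n ℕ.+ s) p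
  extend p occ zero    = subst (λ n → OccursAt w i n p) (sym (ℕ.+-identityʳ n)) occ
  extend p occ (suc s) k k< with ℕ.m≤n⇒m<n∨m≡n (ℕ.≤-pred (subst (suc k ≤_) (ℕ.+-suc n s) k<))
  ... | inj₁ k<n+s = extend p occ s k k<n+s
  ... | inj₂ refl  = forced s p (extend p occ s)

  future : ∀ p → OccursAt w i n p → Future p
  future p occ k = extend p occ (suc k) k (ℕ.m≤n+m (suc k) n)

  P = p₀ ℕ.∸ i

  i+P≡p₀ : i ℕ.+ P ≡ p₀
  i+P≡p₀ = ℕ.m+[n∸m]≡n (ℕ.<⇒≤ i<p₀)

  0<P : 0 < P
  0<P = ℕ.m<n⇒0<n∸m i<p₀

  step-period : ∀ p q → Future p → Future (p ℕ.+ q) → Period T q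
  step-period p q fp fpq k = begin
    T (q ℕ.+ k)             ≡⟨ sym (fp (q ℕ.+ k)) ⟩
    w (p ℕ.+ (q ℕ.+ k))     ≡⟨ cong w (sym (ℕ.+-assoc p q k)) ⟩
    w (p ℕ.+ q ℕ.+ k)       ≡⟨ fpq k ⟩
    T k                     ∎
    where open ≡-Reasoning

  T-period : Period T P
  T-period = step-period i P (λ _ → refl) (subst Future (sym i+P≡p₀) (future p₀ occ₀))

  a = countPrefix l0 T P

  g : ℕ → ℤ
  g p = + P * count l0 w p - + a * (count l0 w p + count l1 w p)

  -- The stretch between the two positions is a prefix of `T` whose length q is a period of `T`, so
  -- its zeros are in the ratio a : P and `g` does not change.
  g-step : ∀ p q → Future p → Future (p ℕ.+ q) → g (p ℕ.+ q) ≡ g p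
  g-step p q fp fpq = begin
    g (p ℕ.+ q)
      ≡⟨ cong (λ z → + P * count l0 w (p ℕ.+ q) - + a * z) (total (p ℕ.+ q)) ⟩
    + P * count l0 w (p ℕ.+ q) - + a * (+ (p ℕ.+ q))
      ≡⟨ cong (λ z → + P * + z - + a * (+ (p ℕ.+ q)))
           (trans (countPrefix-+ l0 w p q) (cong (countPrefix l0 w p ℕ.+_) (countPrefix-cong l0 q λ k _ → fp k))) ⟩
    + P * (count l0 w p + count l0 T q) - + a * (+ p + + q)
      ≡⟨ expand (+ P) (count l0 w p) (count l0 T q) (+ a) (+ p) (+ q) ⟩
    + P * count l0 w p - + a * + p + (+ P * count l0 T q - + q * + a)
      ≡⟨ cong₂ (λ x y → + P * count l0 w p - + a * x + (y - + q * + a)) (sym (total p)) proportional ⟩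
    g p + (+ q * + a - + q * + a)
      ≡⟨ vanish (g p) (+ q * + a) ⟩
    g p ∎
    where
    open ≡-Reasoning
    total : ∀ n → count l0 w n + count l1 w n ≡ + n
    total n = cong +_ (countPrefix-sum w n)
    proportional : + P * count l0 T q ≡ + q * + a
    proportional = trans (sym (ℤ.pos-* P _))
      (trans (cong +_ (period-proportional l0 T T-period (step-period p q fp fpq))) (ℤ.pos-* q a))
    expand : ∀ P x c a p q → P * (x + c) - a * (p + q) ≡ P * x - a * p + (P * c - q * a)
    expand = solve-∀
    vanish : ∀ x y → x + (y - y) ≡ x
    vanish = solve-∀

  g-const : ∀ p → Future p → g p ≡ g i
  g-const p fp with ℕ.≤-total i p
  ... | inj₁ i≤p = trans (cong g (sym e)) (g-step i (p ℕ.∸ i) (λ _ → refl) (subst Future (sym e) fp))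
    where e = ℕ.m+[n∸m]≡n i≤p
  ... | inj₂ p≤i = trans (sym (g-step p (i ℕ.∸ p) fp (subst Future (sym e) λ _ → refl))) (cong g e)
    where e = ℕ.m+[n∸m]≡n p≤i

  -- By WELLDOC modulo P + 1, every (x, y) is met before the factor, so the constant value of `g`
  -- agrees with the form at every (x, y).
  residue : ∀ x y → + suc P ∣ g i - (+ P * x - + a * (x + y))
  residue x y with welldoc-ℤ wd P i n x y
  ... | p , occ , ∣x , ∣y = subst (λ z → + suc P ∣ z - (+ P * x - + a * (x + y))) (g-const p (future p occ))
      (subst (+ suc P ∣_) (linear (+ P) (+ a) (count l0 w p) (count l1 w p) x y)
        (∣m∣n⇒∣m-n (∣n⇒∣m*n (+ P - + a) ∣x) (∣n⇒∣m*n (+ a) ∣y)))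
    where
    linear : ∀ P a u v x y → (P - a) * (u - x) - a * (v - y) ≡ (P * u - a * (u + v)) - (P * x - a * (x + y))
    linear = solve-∀

  -- The form is -a at (0, 1) and P - a at (1, 0); their difference P lies strictly between 0 and P
  -- + 1.
  P∣ : + suc P ∣ + P
  P∣ = subst (+ suc P ∣_) (difference (+ P) (+ a) (g i)) (∣m∣n⇒∣m-n (residue 0ℤ 1ℤ) (residue 1ℤ 0ℤ))
    where
    difference : ∀ P a g → (g - (P * 0ℤ - a * (0ℤ + 1ℤ))) - (g - (P * 1ℤ - a * (1ℤ + 0ℤ))) ≡ P
    difference = solve-∀

-- Rotation of words and conjugation of the morphism.

rotate : List Letter → List Letter
rotate []      = []
rotate (x ∷ u) = u ++ x ∷ []

rotations : ℕ → List Letter → List Letter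
rotations zero    u = u
rotations (suc k) u = rotations k (rotate u)

rotations-suc : ∀ k u → rotations (suc k) u ≡ rotate (rotations k u)
rotations-suc zero    u = refl
rotations-suc (suc k) u = rotations-suc k (rotate u)

rotations-+ : ∀ j k u → rotations (j ℕ.+ k) u ≡ rotations k (rotations j u)
rotations-+ zero    k u = refl
rotations-+ (suc j) k u = rotations-+ j k (rotate u)

rotations-++ : ∀ u v → rotations (length u) (u ++ v) ≡ v ++ u
rotations-++ []      v = sym (List.++-identityʳ v)
rotations-++ (x ∷ u) v = begin
  rotations (length u) ((u ++ v) ++ x ∷ [])   ≡⟨ cong (rotations (length u)) (List.++-assoc u v _) ⟩
  rotations (length u) (u ++ v ++ x ∷ [])     ≡⟨ rotations-++ u (v ++ x ∷ []) ⟩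
  (v ++ x ∷ []) ++ u                          ≡⟨ List.++-assoc v _ u ⟩
  v ++ x ∷ u                                  ∎
  where open ≡-Reasoning

rotations-length : ∀ u → rotations (length u) u ≡ u
rotations-length u = trans (cong (rotations (length u)) (sym (List.++-identityʳ u))) (rotations-++ u [])

length-rotate : ∀ u → length (rotate u) ≡ length u
length-rotate []      = refl
length-rotate (x ∷ u) = trans (List.length-++ u) (ℕ.+-comm (length u) 1)

countL-rotate : ∀ c u → countL c (rotate u) ≡ countL c u
countL-rotate c []      = refl
countL-rotate c (x ∷ u) = trans (countL-++ c u (x ∷ [])) (trans (ℕ.+-comm (countL c u) _) (sym (countL-∷ c x u)))

countL-rotations : ∀ c k u → countL c (rotations k u) ≡ countL c u
countL-rotations c zero    u = refl
countL-rotations c (suc k) u = trans (countL-rotations c k (rotate u)) (countL-rotate c u)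

length-rotations : ∀ k u → length (rotations k u) ≡ length u
length-rotations zero    u = refl
length-rotations (suc k) u = trans (length-rotations k (rotate u)) (length-rotate u)

-- The tail of w from `B 0` on is ψ(w), cut into blocks. The start is left free because conjugation
-- moves it to the right.
record Parse (w : InfWord) (ψ : Morphism) (B : ℕ → ℕ) : Set where
  field
    next  : ∀ j → B (suc j) ≡ B j ℕ.+ length (ψ (w j))
    reads : ∀ j → Reads w (B j) (ψ (w j))

module _ {w : InfWord} where

  parse-cong : ∀ {ψ ψ′ B} → (∀ c → ψ c ≡ ψ′ c) → Parse w ψ B → Parse w ψ′ B
  parse-cong {B = B} e P = record
    { next  = λ j → trans (next j) (cong (λ u → B j ℕ.+ length u) (e (w j)))
    ; reads = λ j → subst (Reads w (B j)) (e (w j)) (reads j)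
    }
    where open Parse P

  -- The letter that follows a block is the first letter t of the next one, so moving t from the
  -- front of each block to its end still matches w, one position later.
  parse-rotate : ∀ {ψ B t} → (∀ c → ∃[ s ] ψ c ≡ t ∷ s) → Parse w ψ B → Parse w (rotate ∘ ψ) (suc ∘ B)
  parse-rotate {ψ} {B} {t} heads P = record { next = next′ ; reads = reads′ }
    where
    open Parse P
    next′ : ∀ j → suc (B (suc j)) ≡ suc (B j ℕ.+ length (rotate (ψ (w j))))
    next′ j = cong suc (trans (next j) (cong (B j ℕ.+_) (sym (length-rotate (ψ (w j))))))
    read-t : ∀ j → w (B j) ≡ t
    read-t j with ψ (w j) | heads (w j) | reads j
    ... | _ | s , refl | e , _ = e
    reads′ : ∀ j → Reads w (suc (B j)) (rotate (ψ (w j)))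
    reads′ j with ψ (w j) | heads (w j) | reads j | next j
    ... | _ | s , refl | _ , r | nx =
      reads-++⁺ w s r (trans (cong w (sym (trans nx (ℕ.+-suc (B j) (length s))))) (read-t (suc j)) , tt)

-- The first letter of a block identifies the block, while `conjugate` says that the matrix is still
-- that of φ.
record Marked (φ : Morphism) (w : InfWord) : Set where
  field
    ψ         : Morphism
    B         : ℕ → ℕ
    parse     : Parse w ψ B
    h₀ h₁     : Letter
    t₀ t₁     : List Letter
    ψ₀        : ψ l0 ≡ h₀ ∷ t₀
    ψ₁        : ψ l1 ≡ h₁ ∷ t₁
    h₀≢h₁     : h₀ ≢ h₁
    conjugate : ∀ d c → countL d (ψ c) ≡ matA φ d c

uncons : ∀ (u : List Letter) → 0 < length u → ∃₂ λ h t → u ≡ h ∷ t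
uncons (h ∷ t) _ = h , t , refl

-- Conjugating both images by their common first letter shifts the parse of w by one; if this never
-- stops, then w has period |φ(w₀)|.
¬¬marked : ∀ φ w → Nonerasing φ → FixedBy φ w → WELLDOC w → Recurrent w → ¬ ¬ Marked φ w
¬¬marked φ w ne fix wd rec unmarked = rightSpecial wd rec 0 L λ s p occ → begin
  w (p ℕ.+ (L ℕ.+ s))   ≡⟨ cong w (swap p L s) ⟩
  w (L ℕ.+ (p ℕ.+ s))   ≡⟨ periodic (p ℕ.+ s) ⟩
  w (p ℕ.+ s)           ≡⟨ occ s (ℕ.+-monoˡ-≤ s (ne (w 0))) ⟩
  w s                   ≡⟨ sym (periodic s) ⟩
  w (L ℕ.+ s)           ∎
  where
  open ≡-Reasoning
  swap : ∀ a b c → a ℕ.+ (b ℕ.+ c) ≡ b ℕ.+ (a ℕ.+ c)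
  swap = ℕ-Solver.solve-∀

  L = length (φ (w 0))

  nonempty : ∀ k c → 0 < length (rotations k (φ c))
  nonempty k c = subst (0 <_) (sym (length-rotations k (φ c))) (ne c)

  parses : ∀ k → Parse w (rotations k ∘ φ) (λ j → k ℕ.+ blockEnd φ w j)
  parses zero    = record { next = λ _ → refl ; reads = fix }
  parses (suc k) with uncons _ (nonempty k l0) | uncons _ (nonempty k l1)
  ... | h₀ , t₀ , e₀ | h₁ , t₁ , e₁ with h₀ ≟ᶠ h₁
  ...   | no h₀≢h₁ = ⊥-elim (unmarked record
            { ψ = rotations k ∘ φ ; B = λ j → k ℕ.+ blockEnd φ w j ; parse = parses k
            ; h₀ = h₀ ; h₁ = h₁ ; t₀ = t₀ ; t₁ = t₁ ; ψ₀ = e₀ ; ψ₁ = e₁ ; h₀≢h₁ = h₀≢h₁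
            ; conjugate = λ d c → countL-rotations d k (φ c) })
  ...   | yes refl = parse-cong (λ c → sym (rotations-suc k (φ c))) (parse-rotate heads (parses k))
    where
    heads : ∀ c → ∃[ s ] rotations k (φ c) ≡ h₀ ∷ s
    heads zero       = t₀ , e₀
    heads (suc zero) = t₁ , e₁

  -- Block 0 of the k-th rotation starts at position k, so its first letter is `w k`; as L rotations
  -- restore φ(w₀), this letter has period L in k.
  first : ∀ k → ∃[ s ] rotations k (φ (w 0)) ≡ w k ∷ s
  first k with rotations k (φ (w 0)) | nonempty k (w 0) | Parse.reads (parses k) 0
  ... | x ∷ s | _ | e , _ = s , cong (_∷ s) (trans (sym e) (cong w (ℕ.+-identityʳ k)))

  periodic : Period w L
  periodic k with first k | first (L ℕ.+ k)
  ... | s , e | s′ , e′ = List.∷-injectiveˡ (begin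
    w (L ℕ.+ k) ∷ s′                              ≡⟨ sym e′ ⟩
    rotations (L ℕ.+ k) (φ (w 0))                 ≡⟨ rotations-+ L k (φ (w 0)) ⟩
    rotations k (rotations L (φ (w 0)))           ≡⟨ cong (rotations k) (rotations-length (φ (w 0))) ⟩
    rotations k (φ (w 0))                         ≡⟨ e ⟩
    w k ∷ s                                       ∎)

-- Finite lists of words and partial maps on them.

wordsUpTo : ℕ → List (List Letter)
wordsUpTo zero    = [] ∷ []
wordsUpTo (suc n) = [] ∷ map (l0 ∷_) (wordsUpTo n) ++ map (l1 ∷_) (wordsUpTo n)

∈-wordsUpTo : ∀ {n} u → length u ≤ n → u ∈ wordsUpTo n
∈-wordsUpTo {zero}  []               _         = here refl
∈-wordsUpTo {suc n} []               _         = here refl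
∈-wordsUpTo {suc n} (zero ∷ u)       (s≤s u≤n) = there (∈-++⁺ˡ (∈-map⁺ _ (∈-wordsUpTo u u≤n)))
∈-wordsUpTo {suc n} (suc zero ∷ u)   (s≤s u≤n) =
  there (∈-++⁺ʳ (map (l0 ∷_) (wordsUpTo n)) (∈-map⁺ _ (∈-wordsUpTo u u≤n)))

module _ {A B : Set} (f : A → Maybe B) where

  ∈-mapMaybe : ∀ {x y} xs → x ∈ xs → f x ≡ just y → y ∈ mapMaybe f xs
  ∈-mapMaybe (x ∷ xs) (here refl) fx≡ rewrite fx≡ = here refl
  ∈-mapMaybe (x ∷ xs) (there x∈)  fx≡ with f x
  ... | just _  = there (∈-mapMaybe xs x∈ fx≡)
  ... | nothing = ∈-mapMaybe xs x∈ fx≡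

  length-mapMaybe-< : ∀ {x} xs → x ∈ xs → f x ≡ nothing → length (mapMaybe f xs) < length xs
  length-mapMaybe-< (x ∷ xs) (here refl) fx≡ rewrite fx≡ = s≤s (List.length-mapMaybe f xs)
  length-mapMaybe-< (x ∷ xs) (there x∈)  fx≡ with f x
  ... | just _  = s≤s (length-mapMaybe-< xs x∈ fx≡)
  ... | nothing = ℕ.m≤n⇒m≤1+n (length-mapMaybe-< xs x∈ fx≡)

-- The automaton of block states against a functional that kills A modulo m.

module Synchronise {φ : Morphism} {w : InfWord} (M : Marked φ w)
                   (wd : WELLDOC w) (rec : Recurrent w)
                   (k : ℕ) (f : Letter → ℤ)
                   (kills : ∀ c → + suc k ∣ f l0 * + matA φ l0 c + f l1 * + matA φ l1 c)
                   (nontrivial : ¬ (+ suc k ∣ f l0 × + suc k ∣ f l1)) where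
  open Marked M
  open Parse parse

  -- A state is the part of the current block of ψ that is still to be read; as the blocks start with
  -- different letters, the next letter of w determines the next state.
  step : Letter → List Letter → Maybe (List Letter)
  step e [] with h₀ ≟ᶠ e
  ... | yes _ = just t₀
  -- On a binary alphabet a letter other than `h₀` is `h₁`.
  ... | no  _ = just t₁
  step e (h ∷ t) with h ≟ᶠ e
  ... | yes _ = just t
  ... | no  _ = nothing

  step-∷ : ∀ h t → step h (h ∷ t) ≡ just t
  step-∷ h t with h ≟ᶠ h
  ... | yes _  = refl
  ... | no h≢h = ⊥-elim (h≢h refl)

  step-dead : ∀ {e h} t → h ≢ e → step e (h ∷ t) ≡ nothing
  step-dead {e} {h} t h≢e with h ≟ᶠ e
  ... | yes h≡e = ⊥-elim (h≢e h≡e)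
  ... | no  _   = refl

  -- After r has been read from position n a block boundary is reached. The length bound puts r into
  -- the finite initial list of candidates.
  StateAt : ℕ → List Letter → Set
  StateAt n r = (∃[ j ] n ℕ.+ length r ≡ B j) × Reads w n r × length r ≤ length t₀ ℕ.+ length t₁

  block-start : ∀ j → ∃[ t ] (step (w (B j)) [] ≡ just t × StateAt (suc (B j)) t)
  block-start j with w j in eq | next j | reads j
  ... | zero | nx | rd rewrite ψ₀ with rd
  ...   | refl , rt with h₀ ≟ᶠ w (B j)
  ...     | yes _ = t₀ , refl , (suc j , sym (trans nx (ℕ.+-suc (B j) _))) , rt , ℕ.m≤m+n _ _
  ...     | no ne = ⊥-elim (ne refl)
  block-start j | suc zero | nx | rd rewrite ψ₁ with rd
  ...   | refl , rt with h₀ ≟ᶠ w (B j)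
  ...     | yes e = ⊥-elim (h₀≢h₁ e)
  ...     | no _  = t₁ , refl , (suc j , sym (trans nx (ℕ.+-suc (B j) _))) , rt , ℕ.m≤n+m _ _

  state-step : ∀ n r → StateAt n r → ∃[ r′ ] (step (w n) r ≡ just r′ × StateAt (suc n) r′)
  state-step n [] ((j , e) , _) rewrite trans (sym (ℕ.+-identityʳ n)) e = block-start j
  state-step n (h ∷ t) ((j , e) , (refl , rt) , t<) =
    t , step-∷ h t , (j , trans (sym (ℕ.+-suc n (length t))) e) , rt , ℕ.≤-trans (ℕ.n≤1+n _) t<

  -- The parse covers only positions from `B 0` on, so a factor at p is tracked from p + K, where a
  -- state exists whatever p is.
  K = B 0

  state-exists : ∀ d → ∃[ r ] StateAt (d ℕ.+ K) r
  state-exists zero    = [] , (0 , ℕ.+-identityʳ K) , tt , z≤n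
  state-exists (suc d) with state-exists d
  ... | r , st with state-step _ r st
  ...   | r′ , _ , st′ = r′ , st′

  -- The states that survive s letters read from position i + K, started from all candidates at
  -- once. They are listed with multiplicity, so the length counts the surviving runs.
  alive : ℕ → ℕ → List (List Letter)
  alive i zero    = wordsUpTo (length t₀ ℕ.+ length t₁)
  alive i (suc s) = mapMaybe (step (w (i ℕ.+ (K ℕ.+ s)))) (alive i s)

  alive-cong : ∀ i p s → OccursAt w i (K ℕ.+ s) p → alive p s ≡ alive i s
  alive-cong i p zero    occ = refl
  alive-cong i p (suc s) occ = cong₂ (λ e → mapMaybe (step e))
    (occ (K ℕ.+ s) (ℕ.≤-reflexive (sym (ℕ.+-suc K s))))
    (alive-cong i p s (occurs-≤ {w} {i} {p = p} (ℕ.+-monoʳ-≤ K (ℕ.n≤1+n s)) occ))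

  -- The automaton is deterministic: a letter sends each state to at most one state.
  alive-+ : ∀ i s d → length (alive i (s ℕ.+ d)) ≤ length (alive i s)
  alive-+ i s zero    = ℕ.≤-reflexive (cong (length ∘ alive i) (ℕ.+-identityʳ s))
  alive-+ i s (suc d) rewrite ℕ.+-suc s d = ℕ.≤-trans (List.length-mapMaybe _ (alive i (s ℕ.+ d))) (alive-+ i s d)

  -- The true state of the parse is among the initial candidates, and the letters of w never kill
  -- it.
  alive-state : ∀ p s → ∃[ r ] (r ∈ alive p s × StateAt (p ℕ.+ (K ℕ.+ s)) r)
  alive-state p zero    with state-exists p
  ... | r , st@(_ , _ , len) = r , ∈-wordsUpTo r len , subst (λ n → StateAt n r) (cong (p ℕ.+_) (sym (ℕ.+-identityʳ K))) st
  alive-state p (suc s) with alive-state p s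
  ... | r , r∈ , st with state-step _ r st
  ...   | r′ , e , st′ = r′ , ∈-mapMaybe _ (alive p s) r∈ e ,
          subst (λ n → StateAt n r′) (sym (trans (cong (p ℕ.+_) (ℕ.+-suc K s)) (ℕ.+-suc p _))) st′

  F : ℕ → ℤ
  F n = f l0 * count l0 w n + f l1 * count l1 w n

  -- A block of ψ has a column of A as its Parikh vector, and `f` sends every column to 0 modulo m.
  F-boundary : ∀ j → + suc k ∣ F (B j) - F K
  F-boundary zero    = subst (+ suc k ∣_) (sym (ℤ.+-inverseʳ (F K))) (divides 0ℤ refl)
  F-boundary (suc j) = subst (+ suc k ∣_) eq (∣m∣n⇒∣m+n (F-boundary j) (kills (w j)))
    where
    open ≡-Reasoning
    count-step : ∀ c → count c w (B (suc j)) ≡ count c w (B j) + + matA φ c (w j)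
    count-step c = cong +_ (trans (cong (countPrefix c w) (next j))
      (trans (countPrefix-reads c w (ψ (w j)) (B j) (reads j))
             (cong (countPrefix c w (B j) ℕ.+_) (conjugate c (w j)))))
    regroup : ∀ a b x y u v z → ((a * x + b * y) - z) + (a * u + b * v) ≡ (a * (x + u) + b * (y + v)) - z
    regroup = solve-∀
    eq : (F (B j) - F K) + (f l0 * + matA φ l0 (w j) + f l1 * + matA φ l1 (w j)) ≡ F (B (suc j)) - F K
    eq = trans (regroup (f l0) (f l1) (count l0 w (B j)) (count l1 w (B j)) (+ matA φ l0 (w j)) (+ matA φ l1 (w j)) (F K))
      (cong₂ (λ x y → (f l0 * x + f l1 * y) - F K) (sym (count-step l0)) (sym (count-step l1)))

  -- If an affine function vanishes modulo m at (0, 0), (1, 0) and (0, 1), then m divides both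
  -- coefficients of its linear part.
  escape : ∀ c → ∃₂ λ x y → ¬ (+ suc k ∣ f l0 * x + f l1 * y + c)
  escape c with + suc k ∣? f l0 * 0ℤ + f l1 * 0ℤ + c | + suc k ∣? f l0 * 1ℤ + f l1 * 0ℤ + c | + suc k ∣? f l0 * 0ℤ + f l1 * 1ℤ + c
  ... | no ∤₀ | _ | _ = _ , _ , ∤₀
  ... | yes _ | no ∤₁ | _ = _ , _ , ∤₁
  ... | yes _ | yes _ | no ∤₂ = _ , _ , ∤₂
  ... | yes ∣₀ | yes ∣₁ | yes ∣₂ = ⊥-elim (nontrivial
        ( subst (+ suc k ∣_) (left (f l0) (f l1) c) (∣m∣n⇒∣m-n ∣₁ ∣₀)
        , subst (+ suc k ∣_) (right (f l0) (f l1) c) (∣m∣n⇒∣m-n ∣₂ ∣₀) ))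
    where
    left : ∀ a b c → (a * 1ℤ + b * 0ℤ + c) - (a * 0ℤ + b * 0ℤ + c) ≡ a
    left = solve-∀
    right : ∀ a b c → (a * 0ℤ + b * 1ℤ + c) - (a * 0ℤ + b * 0ℤ + c) ≡ b
    right = solve-∀

  F-occurs : ∀ i n q → OccursAt w i n q → F (q ℕ.+ n) ≡ F q + (F (i ℕ.+ n) - F i)
  F-occurs i n q occ = trans
    (cong₂ (λ x y → f l0 * x + f l1 * y) (split l0) (split l1))
    (trans (regroup (f l0) (f l1) (count l0 w q) (count l1 w q) (count l0 w i) (count l1 w i) (count l0 v n) (count l1 v n))
      (cong₂ (λ x y → F q + ((f l0 * x + f l1 * y) - F i)) (sym (split′ l0)) (sym (split′ l1))))
    where
    v : InfWord
    v = shift i w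
    split : ∀ c → count c w (q ℕ.+ n) ≡ count c w q + count c v n
    split c = cong +_ (trans (countPrefix-+ c w q n) (cong (countPrefix c w q ℕ.+_) (countPrefix-cong c n occ)))
    split′ : ∀ c → count c w (i ℕ.+ n) ≡ count c w i + count c v n
    split′ c = cong +_ (countPrefix-+ c w i n)
    regroup : ∀ a b x y u v s t → a * (x + s) + b * (y + t) ≡ (a * x + b * y) + ((a * (u + s) + b * (v + t)) - (a * u + b * v))
    regroup = solve-∀

  -- The change of `F` along a factor depends on the factor alone. WELLDOC therefore provides an
  -- occurrence at whose end `F` differs modulo m from `F K`, its value at all boundaries.
  avoid-boundary : ∀ i s → ∃[ q ] (OccursAt w i (K ℕ.+ s) q × ∀ j → q ℕ.+ (K ℕ.+ s) ≢ B j)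
  avoid-boundary i s with escape ((F (i ℕ.+ (K ℕ.+ s)) - F i) - F K)
  ... | x , y , ∤ with welldoc-ℤ wd k i (K ℕ.+ s) x y
  ...   | q , occ , ∣x , ∣y = q , occ , λ j e → ∤ (subst (+ suc k ∣_)
            (trans (cong (λ z → (z - F K) - (f l0 * (X - x) + f l1 * (Y - y))) (F-occurs i (K ℕ.+ s) q occ))
                   (regroup (f l0) (f l1) X Y x y (F (i ℕ.+ (K ℕ.+ s)) - F i) (F K)))
            (∣m∣n⇒∣m-n (subst (λ n → + suc k ∣ F n - F K) (sym e) (F-boundary j))
                       (∣m∣n⇒∣m+n (∣n⇒∣m*n (f l0) ∣x) (∣n⇒∣m*n (f l1) ∣y))))
    where
    X = count l0 w q
    Y = count l1 w q
    regroup : ∀ a b X Y x y d z → (((a * X + b * Y) + d) - z) - (a * (X - x) + b * (Y - y)) ≡ a * x + b * y + (d - z)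
    regroup = solve-∀

  kill : ∀ i s {h t} → h ∷ t ∈ alive i s → h ≢ w (i ℕ.+ (K ℕ.+ s)) → length (alive i (suc s)) < length (alive i s)
  kill i s {h} {t} r∈ h≢ = length-mapMaybe-< (step (w (i ℕ.+ (K ℕ.+ s)))) (alive i s) r∈ (step-dead t h≢)

  -- A right special factor can be followed by a letter that kills any given state inside a block,
  -- and by WELLDOC some alive state is inside a block.
  shrink : ∀ i p s → OccursAt w i (K ℕ.+ s) p → w (p ℕ.+ (K ℕ.+ s)) ≢ w (i ℕ.+ (K ℕ.+ s)) →
           ∃[ j ] length (alive j (suc s)) < length (alive i s)
  shrink i p s occ ne = pick (avoid-boundary i s)
    where
    choose : ∀ {h t} → h ∷ t ∈ alive i s → Dec (h ≡ w (i ℕ.+ (K ℕ.+ s))) → ∃[ j ] length (alive j (suc s)) < length (alive i s)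
    choose r∈ (no  h≢) = i , kill i s r∈ h≢
    choose r∈ (yes h≡) = p , subst (λ l → length (alive p (suc s)) < length l) (alive-cong i p s occ)
      (kill p s (subst (_ ∈_) (sym (alive-cong i p s occ)) r∈) (λ h≡′ → ne (trans (sym h≡′) h≡)))
    pick : ∃[ q ] (OccursAt w i (K ℕ.+ s) q × ∀ j → q ℕ.+ (K ℕ.+ s) ≢ B j) →
           ∃[ j ] length (alive j (suc s)) < length (alive i s)
    pick (q , occq , inside) with alive-state q s
    ... | [] , _ , (j , e) , _ = ⊥-elim (inside j (trans (sym (ℕ.+-identityʳ _)) e))
    ... | h ∷ t , r∈ , _ = choose (subst (h ∷ t ∈_) (alive-cong i q s occq) r∈) (h ≟ᶠ _)

  -- Induction on a bound for the number of alive states. An extension with two continuations would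
  -- yield a factor with fewer alive states, so every extension is forced, against `rightSpecial`.
  never-alive : ∀ n i s → length (alive i s) < n → ⊥
  never-alive (suc n) i s len = rightSpecial wd rec i (K ℕ.+ s) forced
    where
    forced : ∀ d p → OccursAt w i (K ℕ.+ s ℕ.+ d) p → w (p ℕ.+ (K ℕ.+ s ℕ.+ d)) ≡ w (i ℕ.+ (K ℕ.+ s ℕ.+ d))
    forced d p occ with w (p ℕ.+ (K ℕ.+ s ℕ.+ d)) ≟ᶠ w (i ℕ.+ (K ℕ.+ s ℕ.+ d))
    ... | yes e = e
    ... | no ne = ⊥-elim (recurse (shrink i p (s ℕ.+ d) (subst (λ n → OccursAt w i n p) (ℕ.+-assoc K s d) occ)
                                     (subst (λ n → w (p ℕ.+ n) ≢ w (i ℕ.+ n)) (ℕ.+-assoc K s d) ne)))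
      where
      recurse : ¬ (∃[ j ] length (alive j (suc (s ℕ.+ d))) < length (alive i (s ℕ.+ d)))
      recurse (j , lt) = never-alive n j (suc (s ℕ.+ d)) (ℕ.<-≤-trans lt (ℕ.≤-trans (alive-+ i s d) (ℕ.≤-pred len)))

  absurd : ⊥
  absurd = never-alive _ 0 0 ℕ.≤-refl

-- WELLDOC implies determinant 1 or -1.

module _ (φ : Morphism) (w : InfWord) (ne : Nonerasing φ) (fix : FixedBy φ w)
         (rec : Recurrent w) (wd : WELLDOC w) where

  private
    a = + matA φ l0 l0
    b = + matA φ l0 l1
    c = + matA φ l1 l0
    d = + matA φ l1 l1

  -- Divisibility is decidable, so the doubly negated `Marked` is enough to refute the negative
  -- cases.
  no-invariant-functional : ∀ k (f : Letter → ℤ) →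
    (∀ x → + suc k ∣ f l0 * + matA φ l0 x + f l1 * + matA φ l1 x) →
    + suc k ∣ f l0 × + suc k ∣ f l1
  no-invariant-functional k f kills with + suc k ∣? f l0 | + suc k ∣? f l1
  ... | yes ∣₀ | yes ∣₁ = ∣₀ , ∣₁
  ... | no ∤₀  | _      = ⊥-elim (¬¬marked φ w ne fix wd rec λ M →
                            Synchronise.absurd M wd rec k f kills (∤₀ ∘ proj₁))
  ... | _      | no ∤₁  = ⊥-elim (¬¬marked φ w ne fix wd rec λ M →
                            Synchronise.absurd M wd rec k f kills (∤₁ ∘ proj₂))

  private
    functional : ℤ → ℤ → Letter → ℤ
    functional x y zero       = x
    functional x y (suc zero) = y

  -- If m divides det A, the rows (d, -b) and (-c, a) of the adjugate kill A modulo m, so m divides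
  -- a and b. Then (1, 0) kills A as well, and m divides 1.
  det-no-divisor : ∀ k → ¬ (+ suc (suc k) ∣ detA φ)
  det-no-divisor k m∣det = ℕ.<⇒≱ (s≤s (s≤s z≤n)) (ℕ.∣⇒≤ (∣⇒∣ᵤ m∣1))
    where
    m = + suc (suc k)
    adj₀ = no-invariant-functional (suc k) (functional d (- b)) λ where
        zero       → subst (m ∣_) (e₁ a b c d) m∣det
        (suc zero) → subst (m ∣_) (e₂ b d) (divides 0ℤ refl)
      where
      e₁ : ∀ a b c d → a * d - b * c ≡ d * a + - b * c
      e₁ = solve-∀
      e₂ : ∀ b d → 0ℤ ≡ d * b + - b * d
      e₂ = solve-∀
    adj₁ = no-invariant-functional (suc k) (functional (- c) a) λ where
        zero       → subst (m ∣_) (e₁ a c) (divides 0ℤ refl)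
        (suc zero) → subst (m ∣_) (e₂ a b c d) m∣det
      where
      e₁ : ∀ a c → 0ℤ ≡ - c * a + a * c
      e₁ = solve-∀
      e₂ : ∀ a b c d → a * d - b * c ≡ - c * b + a * d
      e₂ = solve-∀
    m∣b : m ∣ b
    m∣b = subst (m ∣_) (ℤ.neg-involutive b) (∣m⇒∣-m (proj₂ adj₀))
    m∣1 : m ∣ 1ℤ
    m∣1 = proj₁ (no-invariant-functional (suc k) (functional 1ℤ 0ℤ) λ where
        zero       → subst (m ∣_) (e a c) (proj₂ adj₁)
        (suc zero) → subst (m ∣_) (e b d) m∣b)
      where
      e : ∀ x y → x ≡ 1ℤ * x + 0ℤ * y
      e = solve-∀

  welldoc⇒unimodular : detA φ ≡ + 1 ⊎ detA φ ≡ - (+ 1)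
  welldoc⇒unimodular with detA φ in eq
  -- A zero determinant is divisible by 2.
  ... | ℤ.+ 0                  = ⊥-elim (det-no-divisor 0 (divides 0ℤ eq))
  ... | ℤ.+ 1                  = inj₁ refl
  ... | ℤ.+ (suc (suc k))      = ⊥-elim (det-no-divisor k (∣ᵤ⇒∣ (ℕ.∣-reflexive (cong ℤ.∣_∣ (sym eq)))))
  ... | ℤ.-[1+ 0 ]             = inj₂ refl
  ... | ℤ.-[1+ suc k ]         = ⊥-elim (det-no-divisor k (∣ᵤ⇒∣ (ℕ.∣-reflexive (cong ℤ.∣_∣ (sym eq)))))

-- Integer vectors modulo m and the action of a unimodular matrix.

ℤ² : Set
ℤ² = ℤ × ℤ

infixl 6 _⊕_
infixl 7 _⊙_

_⊕_ : ℤ² → ℤ² → ℤ²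
(x , y) ⊕ (x′ , y′) = x + x′ , y + y′

_⊙_ : ℤ → ℤ² → ℤ²
z ⊙ (x , y) = z * x , z * y

⊕-assoc : ∀ u v t → u ⊕ v ⊕ t ≡ u ⊕ (v ⊕ t)
⊕-assoc (x , y) (x′ , y′) (x″ , y″) = cong₂ _,_ (ℤ.+-assoc x x′ x″) (ℤ.+-assoc y y′ y″)

⊕-comm : ∀ u v → u ⊕ v ≡ v ⊕ u
⊕-comm (x , y) (x′ , y′) = cong₂ _,_ (ℤ.+-comm x x′) (ℤ.+-comm y y′)

module Congruence (k : ℕ) where

  infix 4 _≈_

  record _≈_ (u v : ℤ²) : Set where
    constructor congruent
    field
      ∣₀ : + suc k ∣ proj₁ u - proj₁ v
      ∣₁ : + suc k ∣ proj₂ u - proj₂ v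

  private
    refl∣ : ∀ x → + suc k ∣ x - x
    refl∣ x = divides 0ℤ (ℤ.+-inverseʳ x)

    sym∣ : ∀ x y → + suc k ∣ x - y → + suc k ∣ y - x
    sym∣ x y p = subst (+ suc k ∣_) (flip x y) (∣m⇒∣-m p)
      where
      flip : ∀ x y → - (x - y) ≡ y - x
      flip = solve-∀

    trans∣ : ∀ x y z → + suc k ∣ x - y → + suc k ∣ y - z → + suc k ∣ x - z
    trans∣ x y z p q = subst (+ suc k ∣_) (telescope x y z) (∣m∣n⇒∣m+n p q)
      where
      telescope : ∀ x y z → (x - y) + (y - z) ≡ x - z
      telescope = solve-∀

    comb∣ : ∀ s t x y x′ y′ → + suc k ∣ x - x′ → + suc k ∣ y - y′ → + suc k ∣ (s * x + t * y) - (s * x′ + t * y′)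
    comb∣ s t x y x′ y′ p q = subst (+ suc k ∣_) (linear s t x y x′ y′) (∣m∣n⇒∣m+n (∣n⇒∣m*n s p) (∣n⇒∣m*n t q))
      where
      linear : ∀ s t x y x′ y′ → s * (x - x′) + t * (y - y′) ≡ (s * x + t * y) - (s * x′ + t * y′)
      linear = solve-∀

    add∣ : ∀ x y x′ y′ → + suc k ∣ x - x′ → + suc k ∣ y - y′ → + suc k ∣ (x + y) - (x′ + y′)
    add∣ x y x′ y′ p q = subst (+ suc k ∣_) (linear x y x′ y′) (∣m∣n⇒∣m+n p q)
      where
      linear : ∀ x y x′ y′ → (x - x′) + (y - y′) ≡ (x + y) - (x′ + y′)
      linear = solve-∀

  ≈-refl : ∀ {u} → u ≈ u
  ≈-refl {x , y} = congruent (refl∣ x) (refl∣ y)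

  ≈-reflexive : ∀ {u v} → u ≡ v → u ≈ v
  ≈-reflexive refl = ≈-refl

  ≈-sym : ∀ {u v} → u ≈ v → v ≈ u
  ≈-sym {x , y} {x′ , y′} (congruent p q) = congruent (sym∣ x x′ p) (sym∣ y y′ q)

  ≈-trans : ∀ {u v t} → u ≈ v → v ≈ t → u ≈ t
  ≈-trans {x , y} {x′ , y′} {x″ , y″} (congruent p q) (congruent p′ q′) =
    congruent (trans∣ x x′ x″ p p′) (trans∣ y y′ y″ q q′)

  ⊕-cong : ∀ {u u′ v v′} → u ≈ u′ → v ≈ v′ → u ⊕ v ≈ u′ ⊕ v′
  ⊕-cong {x , y} {x′ , y′} {z , t} {z′ , t′} (congruent p q) (congruent p′ q′) =
    congruent (add∣ x z x′ z′ p p′) (add∣ y t y′ t′ q q′)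

  ⊙-congˡ : ∀ {z z′} u → + suc k ∣ z - z′ → z ⊙ u ≈ z′ ⊙ u
  ⊙-congˡ {z} {z′} (x , y) p = congruent (scale x) (scale y)
    where
    factor : ∀ z z′ x → x * (z - z′) ≡ z * x - z′ * x
    factor = solve-∀
    scale : ∀ x → + suc k ∣ z * x - z′ * x
    scale x = subst (+ suc k ∣_) (factor z z′ x) (∣n⇒∣m*n x p)

  residues : ℤ² → Fin (suc k ℕ.* suc k)
  residues (x , y) = combine (fromℕ< (ℤ.n%ℕd<d x (suc k))) (fromℕ< (ℤ.n%ℕd<d y (suc k)))

  residues-≈ : ∀ u v → residues u ≡ residues v → u ≈ v
  residues-≈ (x , y) (x′ , y′) e with Fin.combine-injective (fromℕ< (ℤ.n%ℕd<d x (suc k))) (fromℕ< (ℤ.n%ℕd<d y (suc k))) _ _ e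
  ... | p , q = congruent (%ℕ≡⇒∣ (suc k) x x′ (unFin (ℤ.n%ℕd<d x (suc k)) (ℤ.n%ℕd<d x′ (suc k)) p))
              (%ℕ≡⇒∣ (suc k) y y′ (unFin (ℤ.n%ℕd<d y (suc k)) (ℤ.n%ℕd<d y′ (suc k)) q))
    where
    unFin : ∀ {m i j} (i<m : i < m) (j<m : j < m) → fromℕ< i<m ≡ fromℕ< j<m → i ≡ j
    unFin i<m j<m e = trans (sym (Fin.toℕ-fromℕ< i<m)) (trans (cong toℕ e) (Fin.toℕ-fromℕ< j<m))

  module Unimodular (a b c d e : ℤ) (det≡e : a * d - b * c ≡ e) (e²≡1 : e * e ≡ 1ℤ) where

    act : ℤ² → ℤ²
    act (x , y) = a * x + b * y , c * x + d * y

    act-⊕ : ∀ u v → act (u ⊕ v) ≡ act u ⊕ act v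
    act-⊕ (x , y) (x′ , y′) = cong₂ _,_ (linear a b x y x′ y′) (linear c d x y x′ y′)
      where
      linear : ∀ a b x y x′ y′ → a * (x + x′) + b * (y + y′) ≡ (a * x + b * y) + (a * x′ + b * y′)
      linear = solve-∀

    act-⊙ : ∀ z u → act (z ⊙ u) ≡ z ⊙ act u
    act-⊙ z (x , y) = cong₂ _,_ (linear a b x y z) (linear c d x y z)
      where
      linear : ∀ a b x y z → a * (z * x) + b * (z * y) ≡ z * (a * x + b * y)
      linear = solve-∀

    -- As e² = 1, e times the adjugate is an inverse over the integers.
    act-surjective : ∀ v → ∃[ u ] act u ≡ v
    act-surjective (x , y) = (e * (d * x - b * y) , e * (a * y - c * x)) , cong₂ _,_
      (trans (first a b c d e x y) (trans (cong (λ t → e * t * x) det≡e) (unit x)))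
      (trans (second a b c d e x y) (trans (cong (λ t → e * t * y) det≡e) (unit y)))
      where
      first : ∀ a b c d e x y → a * (e * (d * x - b * y)) + b * (e * (a * y - c * x)) ≡ e * (a * d - b * c) * x
      first = solve-∀
      second : ∀ a b c d e x y → c * (e * (d * x - b * y)) + d * (e * (a * y - c * x)) ≡ e * (a * d - b * c) * y
      second = solve-∀
      unit : ∀ x → e * e * x ≡ x
      unit x = trans (cong (_* x) e²≡1) (ℤ.*-identityˡ x)

    act-cong : ∀ {u v} → u ≈ v → act u ≈ act v
    act-cong {x , y} {x′ , y′} (congruent p q) = congruent (comb∣ a b x y x′ y′ p q) (comb∣ c d x y x′ y′ p q)

    act-cancel : ∀ {u v} → act u ≈ act v → u ≈ v
    act-cancel {x , y} {x′ , y′} (congruent p q) = congruent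
      (subst (+ suc k ∣_) (trans (first a b c d e x y x′ y′) (unit (x - x′)))
        (∣n⇒∣m*n e (∣m∣n⇒∣m-n (∣n⇒∣m*n d p) (∣n⇒∣m*n b q))))
      (subst (+ suc k ∣_) (trans (second a b c d e x y x′ y′) (unit (y - y′)))
        (∣n⇒∣m*n e (∣m∣n⇒∣m-n (∣n⇒∣m*n a q) (∣n⇒∣m*n c p))))
      where
      first : ∀ a b c d e x y x′ y′ →
        e * (d * ((a * x + b * y) - (a * x′ + b * y′)) - b * ((c * x + d * y) - (c * x′ + d * y′))) ≡
        e * (a * d - b * c) * (x - x′)
      first = solve-∀
      second : ∀ a b c d e x y x′ y′ →
        e * (a * ((c * x + d * y) - (c * x′ + d * y′)) - c * ((a * x + b * y) - (a * x′ + b * y′))) ≡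
        e * (a * d - b * c) * (y - y′)
      second = solve-∀
      unit : ∀ x → e * (a * d - b * c) * x ≡ x
      unit x = trans (cong (λ t → e * t * x) det≡e) (trans (cong (_* x) e²≡1) (ℤ.*-identityˡ x))

    actⁿ : ℕ → ℤ² → ℤ²
    actⁿ zero    u = u
    actⁿ (suc n) u = act (actⁿ n u)

    actⁿ-+ : ∀ m n u → actⁿ (m ℕ.+ n) u ≡ actⁿ m (actⁿ n u)
    actⁿ-+ zero    n u = refl
    actⁿ-+ (suc m) n u = cong act (actⁿ-+ m n u)

    actⁿ-cong : ∀ n {u v} → u ≈ v → actⁿ n u ≈ actⁿ n v
    actⁿ-cong zero    p = p
    actⁿ-cong (suc n) p = act-cong (actⁿ-cong n p)

    actⁿ-cancel : ∀ n {u v} → actⁿ n u ≈ actⁿ n v → u ≈ v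
    actⁿ-cancel zero    p = p
    actⁿ-cancel (suc n) p = actⁿ-cancel n (act-cancel p)

    actⁿ-surjective : ∀ n v → ∃[ u ] actⁿ n u ≡ v
    actⁿ-surjective zero    v = v , refl
    actⁿ-surjective (suc n) v = preimage (act-surjective v)
      where
      preimage : ∃[ v′ ] act v′ ≡ v → ∃[ u ] actⁿ (suc n) u ≡ v
      preimage (v′ , e′) with actⁿ-surjective n v′
      ... | u , e″ = u , trans (cong act e″) e′

    -- Two of the first m² + 1 iterates agree modulo m, and the common power of the matrix cancels.
    orbit : ∀ u → ∃[ n ] actⁿ (suc n) u ≈ u
    orbit u = collide (Fin.pigeonhole (ℕ.n<1+n (suc k ℕ.* suc k)) (λ i → residues (actⁿ (toℕ i) u)))
      where
      collide : (∃₂ λ i j → toℕ i < toℕ j × residues (actⁿ (toℕ i) u) ≡ residues (actⁿ (toℕ j) u)) → ∃[ n ] actⁿ (suc n) u ≈ u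
      collide (i , j , i<j , same) = n , actⁿ-cancel (toℕ i) {actⁿ (suc n) u} {u} (≈-sym (≈-trans
        (residues-≈ (actⁿ (toℕ i) u) (actⁿ (toℕ j) u) same) (≈-reflexive unfold)))
        where
        n : ℕ
        n = toℕ j ℕ.∸ suc (toℕ i)
        unfold : actⁿ (toℕ j) u ≡ actⁿ (toℕ i) (actⁿ (suc n) u)
        unfold = trans (cong (λ n → actⁿ n u) (sym (trans (ℕ.+-suc (toℕ i) n) (ℕ.m+[n∸m]≡n i<j)))) (actⁿ-+ (toℕ i) (suc n) u)

    orbit-* : ∀ n {u} → actⁿ n u ≈ u → ∀ r → actⁿ (r ℕ.* n) u ≈ u
    orbit-* n     p zero    = ≈-refl
    orbit-* n {u} p (suc r) =
      ≈-trans (≈-reflexive (actⁿ-+ n (r ℕ.* n) u)) (≈-trans (actⁿ-cong n (orbit-* n p r)) p)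

    -- Multiples of a return time are return times. Late returns are wanted because φⁿ(w₀) must be
    -- long enough to cover a given prefix.
    late-return : ∀ u r → ∃[ n ] (r ≤ n × actⁿ n u ≈ u)
    late-return u r = multiple (orbit u)
      where
      multiple : ∃[ n ] actⁿ (suc n) u ≈ u → ∃[ n ] (r ≤ n × actⁿ n u ≈ u)
      multiple (n , p) = r ℕ.* suc n , ℕ.m≤m*n r (suc n) , orbit-* (suc n) p r

-- Binary letters, changes of letter, and Parikh vectors.

binary : ∀ {a b : Letter} → b ≢ a → ∀ c → c ≡ a ⊎ c ≡ b
binary {zero}     {zero}     b≢a _          = ⊥-elim (b≢a refl)
binary {zero}     {suc zero} _   zero       = inj₁ refl
binary {zero}     {suc zero} _   (suc zero) = inj₂ refl
binary {suc zero} {zero}     _   zero       = inj₂ refl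
binary {suc zero} {zero}     _   (suc zero) = inj₁ refl
binary {suc zero} {suc zero} b≢a _          = ⊥-elim (b≢a refl)

δ-distinct : ∀ c {x y} → x ≢ y → δ c x ℕ.+ δ c y ≡ 1
δ-distinct c          {zero}     {zero}     x≢y = ⊥-elim (x≢y refl)
δ-distinct zero       {zero}     {suc zero} _   = refl
δ-distinct (suc zero) {zero}     {suc zero} _   = refl
δ-distinct zero       {suc zero} {zero}     _   = refl
δ-distinct (suc zero) {suc zero} {zero}     _   = refl
δ-distinct c          {suc zero} {suc zero} x≢y = ⊥-elim (x≢y refl)

transition : ∀ (w : InfWord) i d → w (i ℕ.+ d) ≢ w i → ∃[ n ] (w n ≡ w i × w (suc n) ≡ w (i ℕ.+ d))
transition w i zero    ne = ⊥-elim (ne (cong w (ℕ.+-identityʳ i)))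
transition w i (suc d) ne with w (i ℕ.+ d) ≟ᶠ w i
... | yes e = i ℕ.+ d , e , cong w (sym (ℕ.+-suc i d))
... | no ne′ with binary ne (w (i ℕ.+ d)) | transition w i d ne′
...   | inj₁ e | _             = ⊥-elim (ne′ e)
...   | inj₂ e | n , e₁ , e₂ = n , e₁ , trans e₂ e

split-at : ∀ c u → countL c u ≢ 0 → ∃₂ λ v t → u ≡ v ++ c ∷ t
split-at c []      nz = ⊥-elim (nz refl)
split-at c (x ∷ u) nz with x ≟ᶠ c
... | yes refl = [] , u , refl
... | no _ with split-at c u nz
...   | v , t , e = x ∷ v , t , cong (x ∷_) e

parity : ∀ n → ∃[ j ] (n ≡ j ℕ.+ j ⊎ n ≡ suc (j ℕ.+ j))
parity zero    = 0 , inj₁ refl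
parity (suc n) with parity n
... | j , inj₁ refl = j , inj₂ refl
... | j , inj₂ refl = suc j , inj₁ (cong suc (sym (ℕ.+-suc j j)))

vec : InfWord → ℕ → ℤ²
vec w n = count l0 w n , count l1 w n

parikh : List Letter → ℤ²
parikh u = + countL l0 u , + countL l1 u

vec-reads : ∀ w u p → Reads w p u → vec w (p ℕ.+ length u) ≡ vec w p ⊕ parikh u
vec-reads w u p r = cong₂ _,_ (cong +_ (countPrefix-reads l0 w u p r)) (cong +_ (countPrefix-reads l1 w u p r))

letter : Letter → ℤ²
letter c = parikh (c ∷ [])

vec-suc : ∀ w p → vec w (suc p) ≡ vec w p ⊕ letter (w p)
vec-suc w p = cong₂ _,_ (cong +_ (countPrefix-suc l0 w p)) (cong +_ (countPrefix-suc l1 w p))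

combination : ∀ v → v ≡ proj₁ v ⊙ letter l0 ⊕ proj₂ v ⊙ letter l1
combination (x , y) = cong₂ _,_ (first x y) (second x y)
  where
  first : ∀ x y → x ≡ x * 1ℤ + y * 0ℤ
  first = solve-∀
  second : ∀ x y → y ≡ x * 0ℤ + y * 1ℤ
  second = solve-∀

-- Iterated block boundaries and images of occurrences.

module Blocks (φ : Morphism) (w : InfWord) (ne : Nonerasing φ) (fix : FixedBy φ w)
              (long : 2 ≤ length (φ (w 0))) where

  B : ℕ → ℕ
  B = blockEnd φ w

  B-grows : ∀ n → suc n < B (suc n)
  B-grows zero    = long
  B-grows (suc n) = ℕ.≤-trans (ℕ.≤-reflexive (ℕ.+-comm 1 (suc (suc n)))) (ℕ.+-mono-≤ (B-grows n) (ne (w (suc n))))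

  -- The length of φ^k applied to the prefix of length n; thus the prefix of length `Bⁿ k 1` is
  -- φ^k(w₀).
  Bⁿ : ℕ → ℕ → ℕ
  Bⁿ zero    n = n
  Bⁿ (suc k) n = B (Bⁿ k n)

  Bⁿ-grows : ∀ k → k < Bⁿ k 1
  Bⁿ-grows zero    = s≤s z≤n
  Bⁿ-grows (suc k) with Bⁿ k 1 | Bⁿ-grows k
  ... | suc n | k<n = ℕ.≤-trans (s≤s k<n) (B-grows n)

  -- φ maps a copy of a prefix to a copy of its image, which is again a prefix. Both claims go
  -- through one induction, since block p + n must be located before it is compared with block n.
  B-occurs : ∀ p n → OccursAt w 0 n p → OccursAt w 0 (B n) (B p) × B (p ℕ.+ n) ≡ B p ℕ.+ B n
  B-occurs p zero    occ = (λ _ ()) , trans (cong B (ℕ.+-identityʳ p)) (sym (ℕ.+-identityʳ (B p)))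
  B-occurs p (suc n) occ with B-occurs p n (occurs-≤ {w} {0} {p = p} (ℕ.n≤1+n n) occ)
  ... | occ′ , e =
    occurs-++ {w} {0} {B n} {length (φ (w n))} {B p} occ′
      (reads⇒occurs (φ (w n)) (subst₂ (Reads w) e (cong φ (occ n ℕ.≤-refl)) (fix (p ℕ.+ n))) (fix n)) ,
    trans (cong B (ℕ.+-suc p n))
      (trans (cong₂ (λ q c → q ℕ.+ length (φ c)) e (occ n ℕ.≤-refl)) (ℕ.+-assoc (B p) (B n) _))

  Bⁿ-occurs : ∀ k p → w p ≡ w 0 → OccursAt w 0 (Bⁿ k 1) (Bⁿ k p)
  Bⁿ-occurs zero    p e zero    _         = trans (cong w (ℕ.+-identityʳ p)) e
  Bⁿ-occurs zero    p e (suc _) (s≤s ())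
  Bⁿ-occurs (suc k) p e = proj₁ (B-occurs (Bⁿ k p) (Bⁿ k 1) (Bⁿ-occurs k p e))

  vec-occurs : ∀ p n → OccursAt w 0 n p → vec w (p ℕ.+ n) ≡ vec w p ⊕ vec w n
  vec-occurs p n occ = cong₂ _,_ (cong +_ (split l0)) (cong +_ (split l1))
    where
    split : ∀ c → countPrefix c w (p ℕ.+ n) ≡ countPrefix c w p ℕ.+ countPrefix c w n
    split c = trans (countPrefix-+ c w p n) (cong (countPrefix c w p ℕ.+_) (countPrefix-cong c n occ))

  B-first : ∀ p → w p ≡ w 0 → w (B p) ≡ w 0
  B-first p e = trans (cong w (sym (ℕ.+-identityʳ (B p)))) (Bⁿ-occurs 1 p e 0 (ℕ.≤-trans (s≤s z≤n) (Bⁿ-grows 1)))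

-- Adjacent letters of w, and the letter a inside φ(b).

module Recurrence (φ : Morphism) (w : InfWord) (ne : Nonerasing φ) (fix : FixedBy φ w)
                  (rec : Recurrent w) (long : 2 ≤ length (φ (w 0)))
                  (i₁ : ℕ) (b≢a : w i₁ ≢ w 0) where
  open Blocks φ w ne fix long public

  private
    a = w 0
    b = w i₁

  -- Were a to occur just once in φ(a) and not in φ(b), it would occur just once in w.
  a-in-φ[b] : matA φ a a ≡ 1 → matA φ a b ≢ 0
  a-in-φ[b] paa≡1 pab≡0 with rec 0 1 1
  -- The prefix of length p + 1 contains two a's and lies inside φ^p(a), which contains only one.
  ... | p , 1≤p , occ = ℕ.<⇒≱ two (ℕ.≤-trans (countPrefix-≤ a w (Bⁿ-grows p)) (ℕ.≤-reflexive (iterate p)))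
    where
    open ≡-Reasoning
    first : ∀ x y → 1 ℕ.* x ℕ.+ 0 ℕ.* y ≡ x
    first = ℕ-Solver.solve-∀
    second : ∀ x y → 0 ℕ.* x ℕ.+ 1 ℕ.* y ≡ y
    second = ℕ-Solver.solve-∀
    preserved : ∀ a b → b ≢ a → matA φ a a ≡ 1 → matA φ a b ≡ 0 → ∀ n → countPrefix a w (B n) ≡ countPrefix a w n
    preserved zero (suc zero) _ e₁ e₀ n = trans (countPrefix-blockEnd φ w fix l0 n)
      (trans (cong₂ (λ x y → x ℕ.* _ ℕ.+ y ℕ.* _) e₁ e₀) (first (countPrefix l0 w n) (countPrefix l1 w n)))
    preserved (suc zero) zero _ e₁ e₀ n = trans (countPrefix-blockEnd φ w fix l1 n)
      (trans (cong₂ (λ x y → y ℕ.* _ ℕ.+ x ℕ.* _) e₁ e₀) (second (countPrefix l0 w n) (countPrefix l1 w n)))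
    preserved zero       zero       b≢a = ⊥-elim (b≢a refl)
    preserved (suc zero) (suc zero) b≢a = ⊥-elim (b≢a refl)
    one : countPrefix a w 1 ≡ 1
    one = trans (countPrefix-suc a w 0) (δ-refl a)
    iterate : ∀ k → countPrefix a w (Bⁿ k 1) ≡ 1
    iterate zero    = one
    iterate (suc k) = trans (preserved a b b≢a paa≡1 pab≡0 (Bⁿ k 1)) (iterate k)
    wp≡a : w p ≡ a
    wp≡a = trans (cong w (sym (ℕ.+-identityʳ p))) (occ 0 (s≤s z≤n))
    two : 2 ≤ countPrefix a w (suc p)
    two = subst (2 ≤_) (sym (trans (countPrefix-suc a w p) (cong (countPrefix a w p ℕ.+_) (trans (cong (δ a) wp≡a) (δ-refl a)))))
      (ℕ.+-monoˡ-≤ 1 (subst (_≤ countPrefix a w p) one (countPrefix-≤ a w 1≤p)))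

  a-b : ∃[ n ] (w n ≡ a × w (suc n) ≡ b)
  a-b = transition w 0 i₁ b≢a

  b-a : ∃[ n ] (w n ≡ b × w (suc n) ≡ a)
  b-a with rec 0 1 i₁
  ... | p , i₁≤p , occ = back (transition w i₁ (p ℕ.∸ i₁) (λ e → b≢a (trans (sym e) wp≡a)))
    where
    wp≡a : w (i₁ ℕ.+ (p ℕ.∸ i₁)) ≡ a
    wp≡a = trans (cong w (trans (ℕ.m+[n∸m]≡n i₁≤p) (sym (ℕ.+-identityʳ p)))) (occ 0 (s≤s z≤n))
    back : ∃[ n ] (w n ≡ b × w (suc n) ≡ w (i₁ ℕ.+ (p ℕ.∸ i₁))) → ∃[ n ] (w n ≡ b × w (suc n) ≡ a)
    back (n , e , e′) = n , e , trans e′ wp≡a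

  module Alternating (alt : ∀ i → i < B 2 → w i ≢ w (suc i)) where

    alternates : ∀ j → j ℕ.+ j ≤ B 2 → w (j ℕ.+ j) ≡ a × (∀ c → countPrefix c w (j ℕ.+ j) ≡ j)
    alternates zero    _ = refl , λ _ → refl
    alternates (suc j) le rewrite ℕ.+-suc j j with alternates j (ℕ.≤-trans (ℕ.n≤1+n _) (ℕ.≤-trans (ℕ.n≤1+n _) le))
    ... | e , counts = return , λ c → begin
      countPrefix c w (suc (suc n))                                   ≡⟨ countPrefix-suc c w (suc n) ⟩
      countPrefix c w (suc n) ℕ.+ δ c (w (suc n))                     ≡⟨ cong (ℕ._+ δ c (w (suc n))) (countPrefix-suc c w n) ⟩
      countPrefix c w n ℕ.+ δ c (w n) ℕ.+ δ c (w (suc n))             ≡⟨ ℕ.+-assoc (countPrefix c w n) _ _ ⟩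
      countPrefix c w n ℕ.+ (δ c (w n) ℕ.+ δ c (w (suc n)))           ≡⟨ cong₂ ℕ._+_ (counts c) (δ-distinct c n≢) ⟩
      j ℕ.+ 1                                                         ≡⟨ ℕ.+-comm j 1 ⟩
      suc j                                                           ∎
      where
      open ≡-Reasoning
      n = j ℕ.+ j
      n≢ : w n ≢ w (suc n)
      n≢ = alt n (ℕ.≤-trans (ℕ.n≤1+n _) le)
      return : w (suc (suc n)) ≡ a
      return with binary n≢ (w (suc (suc n)))
      ... | inj₁ e′ = ⊥-elim (alt (suc n) le (sym e′))
      ... | inj₂ e′ = trans e′ e

    3≤B2 : 3 ≤ B 2
    3≤B2 = B-grows 1

    w[B2] : w (B 2) ≡ a
    w[B2] = B-first 2 (proj₁ (alternates 1 (ℕ.≤-trans (ℕ.n≤1+n 2) 3≤B2)))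

    -- Block 2 starts with a because w₂ = a. Were its position odd, the letter before it would be a
    -- too.
    even : ∃[ j ] (2 ≤ j × B 2 ≡ j ℕ.+ j)
    even with parity (B 2)
    ... | j , inj₂ e = ⊥-elim (alt (j ℕ.+ j) (ℕ.≤-reflexive (sym e))
            (trans (proj₁ (alternates j (ℕ.≤-trans (ℕ.n≤1+n _) (ℕ.≤-reflexive (sym e))))) (trans (sym w[B2]) (cong w e))))
    ... | 0           , inj₁ e = ⊥-elim (ℕ.<⇒≱ 3≤B2 (ℕ.≤-trans (ℕ.≤-reflexive e) z≤n))
    ... | 1           , inj₁ e = ⊥-elim (ℕ.<⇒≱ 3≤B2 (ℕ.≤-reflexive e))
    ... | suc (suc j) , inj₁ e = suc (suc j) , s≤s (s≤s z≤n) , e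

    -- The prefix of length 2 has Parikh vector (1, 1) and its image, which alternates, has (j, j).
    row-sum : ∀ {j} → B 2 ≡ j ℕ.+ j → ∀ c → matA φ c l0 ℕ.+ matA φ c l1 ≡ j
    row-sum {j} e c = begin
      matA φ c l0 ℕ.+ matA φ c l1
        ≡⟨ sym (cong₂ ℕ._+_ (ℕ.*-identityʳ (matA φ c l0)) (ℕ.*-identityʳ (matA φ c l1))) ⟩
      matA φ c l0 ℕ.* 1 ℕ.+ matA φ c l1 ℕ.* 1
        ≡⟨ sym (cong₂ (λ x y → matA φ c l0 ℕ.* x ℕ.+ matA φ c l1 ℕ.* y) (counts l0) (counts l1)) ⟩
      matA φ c l0 ℕ.* countPrefix l0 w 2 ℕ.+ matA φ c l1 ℕ.* countPrefix l1 w 2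
        ≡⟨ sym (countPrefix-blockEnd φ w fix c 2) ⟩
      countPrefix c w (B 2)
        ≡⟨ trans (cong (countPrefix c w) e) (proj₂ (alternates j (ℕ.≤-reflexive (sym e))) c) ⟩
      j ∎
      where
      open ≡-Reasoning
      counts = proj₂ (alternates 1 (ℕ.≤-trans (ℕ.n≤1+n 2) 3≤B2))

    -- With both row sums equal to j, the determinant is j times the difference of the entries of
    -- the first column.
    det-divisible : ∃[ j ] (2 ≤ j × + j ∣ detA φ)
    det-divisible with even
    ... | j , 2≤j , e = j , 2≤j , subst (+ j ∣_) (sym eq) (∣m⇒∣m*n (α - γ) ∣-refl)
      where
      α = + matA φ l0 l0
      γ = + matA φ l1 l0
      row : ∀ c → + matA φ c l1 ≡ + j - + matA φ c l0
      row c = trans (isolate (+ matA φ c l0) (+ matA φ c l1)) (cong (λ s → + s - + matA φ c l0) (row-sum e c))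
        where
        isolate : ∀ x y → y ≡ (x + y) - x
        isolate = solve-∀
      factor : ∀ α γ j → α * (j - γ) - (j - α) * γ ≡ j * (α - γ)
      factor = solve-∀
      eq : detA φ ≡ + j * (α - γ)
      eq = trans (cong₂ (λ x y → α * y - x * γ) (row l0) (row l1)) (factor α γ (+ j))

  -- If the prefix φ(w₀w₁) of w alternates, then both rows of A have the sum |φ(w₀w₁)|/2 > 1, which divides det A.
  repetition : ℤ.∣ detA φ ∣ ≡ 1 → ∃[ i ] w i ≡ w (suc i)
  repetition det with ℕ.anyUpTo? (λ i → w i ≟ᶠ w (suc i)) (B 2)
  ... | yes (i , _ , e) = i , e
  ... | no none with Alternating.det-divisible (λ i i< e → none (i , i< , e))
  ...   | j , 2≤j , j∣ = ⊥-elim (ℕ.<⇒≱ 2≤j (ℕ.∣⇒≤ (subst (j ℕ.∣_) det (∣⇒∣ᵤ j∣))))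

  -- Otherwise A is triangular, so its diagonal entries are 1 and φ(a) contains a exactly once,
  -- which `a-in-φ[b]` excludes.
  φ[b]-contains-a : ℤ.∣ detA φ ∣ ≡ 1 → ∃₂ λ v t → φ b ≡ v ++ a ∷ t
  φ[b]-contains-a det = split-at a (φ b) λ pab≡0 → a-in-φ[b] (triangular a b b≢a pab≡0 det) pab≡0
    where
    lower : ∀ α β γ d → β ≡ 0 → ℤ.∣ (+ α * + d) - (+ β * + γ) ∣ ≡ 1 → α ≡ 1 × d ≡ 1
    lower α .0 γ d refl e = ℕ.m*n≡1⇒m≡1 α d αd≡1 , ℕ.m*n≡1⇒n≡1 α d αd≡1
      where
      drop : ∀ x y → x - 0ℤ * y ≡ x
      drop = solve-∀
      αd≡1 : α ℕ.* d ≡ 1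
      αd≡1 = trans (sym (ℤ.abs-* (+ α) (+ d))) (trans (cong ℤ.∣_∣ (sym (drop (+ α * + d) (+ γ)))) e)
    swap : ∀ x y z t → x * y - z * t ≡ x * y - t * z
    swap = solve-∀
    triangular : ∀ a b → b ≢ a → matA φ a b ≡ 0 → ℤ.∣ detA φ ∣ ≡ 1 → matA φ a a ≡ 1
    triangular zero (suc zero) _ z e = proj₁ (lower (matA φ l0 l0) _ (matA φ l1 l0) (matA φ l1 l1) z e)
    triangular (suc zero) zero _ z e = proj₂ (lower (matA φ l0 l0) _ (matA φ l0 l1) (matA φ l1 l1) z
      (trans (cong ℤ.∣_∣ (swap (+ matA φ l0 l0) (+ matA φ l1 l1) (+ matA φ l1 l0) (+ matA φ l0 l1))) e))
    triangular zero       zero       b≢a = ⊥-elim (b≢a refl)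
    triangular (suc zero) (suc zero) b≢a = ⊥-elim (b≢a refl)

-- The group of residues before a, and WELLDOC from a unimodular matrix.

module Sufficiency (φ : Morphism) (w : InfWord) (ne : Nonerasing φ) (fix : FixedBy φ w)
                   (rec : Recurrent w) (long : 2 ≤ length (φ (w 0)))
                   (i₁ : ℕ) (b≢a : w i₁ ≢ w 0)
                   (abs≡1 : ℤ.∣ detA φ ∣ ≡ 1) (square≡1 : detA φ * detA φ ≡ 1ℤ) (k : ℕ) where
  open Recurrence φ w ne fix rec long i₁ b≢a
  open Congruence k
  open Unimodular (+ matA φ l0 l0) (+ matA φ l0 l1) (+ matA φ l1 l0) (+ matA φ l1 l1) (detA φ) refl square≡1

  private
    a = w 0
    b = w i₁

  vec-B : ∀ n → vec w (B n) ≡ act (vec w n)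
  vec-B n = cong₂ _,_ (row l0) (row l1)
    where
    row : ∀ c → count c w (B n) ≡ + matA φ c l0 * count l0 w n + + matA φ c l1 * count l1 w n
    row c = trans (cong +_ (countPrefix-blockEnd φ w fix c n))
      (cong₂ _+_ (ℤ.pos-* (matA φ c l0) (countPrefix l0 w n)) (ℤ.pos-* (matA φ c l1) (countPrefix l1 w n)))

  vec-Bⁿ : ∀ j n → vec w (Bⁿ j n) ≡ actⁿ j (vec w n)
  vec-Bⁿ zero    n = refl
  vec-Bⁿ (suc j) n = trans (vec-B (Bⁿ j n)) (cong act (vec-Bⁿ j n))

  H : ℤ² → Set
  H v = ∃[ q ] (w q ≡ a × vec w q ≈ v)

  H-resp : ∀ {u v} → u ≈ v → H u → H v
  H-resp u≈v (q , e , p) = q , e , ≈-trans p u≈v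

  H-vec : ∀ q {v} → w q ≡ a → vec w q ≡ v → H v
  H-vec q e p = q , e , ≈-reflexive p

  H-act : ∀ {u} → H u → H (act u)
  H-act (q , e , p) = B q , B-first q e , ≈-trans (≈-reflexive (vec-B q)) (act-cong p)

  -- φ^j(a) is a prefix of w longer than j, and an a at q puts a copy of it at `Bⁿ j q`.
  lift-occurs : ∀ j {q} → w q ≡ a → ∀ r → r ≤ j →
                w (Bⁿ j q ℕ.+ r) ≡ w r × vec w (Bⁿ j q ℕ.+ r) ≡ actⁿ j (vec w q) ⊕ vec w r
  lift-occurs j {q} e r r≤j = occ r r< , trans
    (vec-occurs (Bⁿ j q) r (occurs-≤ {w} {0} {p = Bⁿ j q} (ℕ.<⇒≤ r<) occ)) (cong (_⊕ vec w r) (vec-Bⁿ j q))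
    where
    occ : OccursAt w 0 (Bⁿ j 1) (Bⁿ j q)
    occ = Bⁿ-occurs j q e
    r< : r < Bⁿ j 1
    r< = ℕ.≤-<-trans r≤j (Bⁿ-grows j)

  -- The prefix of length r + 1 recurs at a position with Parikh vector Aⁿ V_q, and Aⁿ fixes V_q
  -- modulo m for arbitrarily large n.
  H-⊕ : ∀ {u v} → H u → H v → H (u ⊕ v)
  H-⊕ {u} (q , eq , pq) (r , er , pr) = place (late-return u r)
    where
    place : ∃[ n ] (r ≤ n × actⁿ n u ≈ u) → H (u ⊕ _)
    place (n , r≤n , back) with lift-occurs n eq r r≤n
    ... | e , p = Bⁿ n q ℕ.+ r , trans e er ,
      ≈-trans (≈-reflexive p) (⊕-cong (≈-trans (actⁿ-cong n pq) back) pr)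

  -- Modulo m the scalar z may be replaced by its remainder, a natural number, and repeated addition
  -- applies; this also supplies inverses.
  H-⊙ : ∀ z {u} → H u → H (z ⊙ u)
  H-⊙ z {u} h = H-resp (⊙-congˡ {+ (z ℤ.%ℕ suc k)} {z} u reduce) (times (z ℤ.%ℕ suc k))
    where
    zeros : ∀ x y → (0ℤ , 0ℤ) ≡ 0ℤ ⊙ (x , y)
    zeros x y = cong₂ _,_ (zero* x) (zero* y)
      where
      zero* : ∀ x → 0ℤ ≡ 0ℤ * x
      zero* = solve-∀
    sucs : ∀ n x y → (x , y) ⊕ n ⊙ (x , y) ≡ (1ℤ + n) ⊙ (x , y)
    sucs n x y = cong₂ _,_ (suc* n x) (suc* n y)
      where
      suc* : ∀ n x → x + n * x ≡ (1ℤ + n) * x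
      suc* = solve-∀
    times : ∀ n → H (+ n ⊙ u)
    times zero    = H-vec 0 refl (zeros (proj₁ u) (proj₂ u))
    times (suc n) = subst H (sucs (+ n) (proj₁ u) (proj₂ u)) (H-⊕ h (times n))
    reduce : + suc k ∣ + (z ℤ.%ℕ suc k) - z
    reduce = %ℕ≡⇒∣ (suc k) (+ (z ℤ.%ℕ suc k)) z (ℕ.m<n⇒m%n≡m (ℤ.n%ℕd<d z (suc k)))

  H-cancelˡ : ∀ {u v} → H u → H (u ⊕ v) → H v
  H-cancelˡ {x , y} {x′ , y′} hu huv = subst H (cong₂ _,_ (cancel x x′) (cancel y y′)) (H-⊕ huv (H-⊙ (- 1ℤ) hu))
    where
    cancel : ∀ x y → (x + y) + - 1ℤ * x ≡ y
    cancel = solve-∀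

  H-cancelʳ : ∀ {u v} → H v → H (u ⊕ v) → H u
  H-cancelʳ {u} {v} hv huv = H-cancelˡ hv (subst H (⊕-comm u v) huv)

  private
    letters : ∀ {P : Letter → Set} → P a → P b → ∀ c → P c
    letters {P} pa pb c with binary b≢a c
    ... | inj₁ e = subst P (sym e) pa
    ... | inj₂ e = subst P (sym e) pb

  H-all : H (letter a) → H (letter b) → ∀ v → H v
  H-all ha hb v = subst H (sym (combination v)) (H-⊕ (H-⊙ (proj₁ v) (h l0)) (H-⊙ (proj₂ v) (h l1)))
    where
    h : ∀ c → H (letter c)
    h = letters {H ∘ letter} ha hb

  -- A is onto, so each v is A u, a combination of the images of the two letters.
  H-all-act : H (act (letter a)) → H (act (letter b)) → ∀ v → H v
  H-all-act ha hb v = subst H (proj₂ (act-surjective v)) (image (proj₁ (act-surjective v)))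
    where
    h : ∀ c → H (act (letter c))
    h = letters {H ∘ act ∘ letter} ha hb
    image : ∀ u → H (act u)
    image u = subst H (sym (begin
      act u                                                                     ≡⟨ cong act (combination u) ⟩
      act (proj₁ u ⊙ letter l0 ⊕ proj₂ u ⊙ letter l1)                           ≡⟨ act-⊕ (proj₁ u ⊙ letter l0) (proj₂ u ⊙ letter l1) ⟩
      act (proj₁ u ⊙ letter l0) ⊕ act (proj₂ u ⊙ letter l1)                     ≡⟨ cong₂ _⊕_ (act-⊙ (proj₁ u) (letter l0)) (act-⊙ (proj₂ u) (letter l1)) ⟩
      proj₁ u ⊙ act (letter l0) ⊕ proj₂ u ⊙ act (letter l1)                     ∎))
      (H-⊕ (H-⊙ (proj₁ u) (h l0)) (H-⊙ (proj₂ u) (h l1)))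
      where open ≡-Reasoning

  next-vec : ∀ n {c} → w n ≡ c → vec w (suc n) ≡ vec w n ⊕ letter c
  next-vec n refl = vec-suc w n

  -- φ(b) contains an a at offset τ, so AV + τ ∈ H for the vector V before any b. Two adjacent b's
  -- give Ab ∈ H, then ba gives τ ∈ H, and ab gives Aa ∈ H.
  from-bb : ∀ n → w n ≡ b → w (suc n) ≡ b → ∀ v → H v
  from-bb n e e′ = with-a (φ[b]-contains-a abs≡1)
    where
    with-a : (∃₂ λ v t → φ b ≡ v ++ a ∷ t) → ∀ v → H v
    with-a (v , t , φb≡) = combine-transitions a-b b-a
      where
      τ : ℤ²
      τ = parikh v

      in-block : ∀ n → w n ≡ b → H (act (vec w n) ⊕ τ)
      in-block n e with reads-++⁻ w v (subst (Reads w (B n)) (trans (cong φ e) φb≡) (fix n))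
      ... | rv , ra , _ = H-vec (B n ℕ.+ length v) ra (trans (vec-reads w v (B n) rv) (cong (_⊕ τ) (vec-B n)))

      act-next : ∀ n {c} → w n ≡ c → act (vec w (suc n)) ≡ act (vec w n) ⊕ act (letter c)
      act-next n {c} e = trans (cong act (next-vec n e)) (act-⊕ (vec w n) (letter c))

      H-Ab : H (act (letter b))
      H-Ab = H-cancelˡ (in-block n e) (subst H rearranged (in-block (suc n) e′))
        where
        rearranged : act (vec w (suc n)) ⊕ τ ≡ act (vec w n) ⊕ τ ⊕ act (letter b)
        rearranged = trans (cong (_⊕ τ) (act-next n e))
          (trans (⊕-assoc (act (vec w n)) (act (letter b)) τ)
            (trans (cong (act (vec w n) ⊕_) (⊕-comm (act (letter b)) τ)) (sym (⊕-assoc (act (vec w n)) τ (act (letter b))))))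

      H-before-a : ∀ n → w n ≡ a → H (act (vec w n))
      H-before-a n e = H-act (H-vec n e refl)

      combine-transitions : ∃[ n ] (w n ≡ a × w (suc n) ≡ b) → ∃[ n ] (w n ≡ b × w (suc n) ≡ a) → ∀ v → H v
      combine-transitions (i , ia , ib) (j , jb , ja) = H-all-act H-Aa H-Ab
        where
        H-τ : H τ
        H-τ = H-cancelˡ {act (vec w j)} (H-cancelʳ H-Ab (subst H (act-next j jb) (H-before-a (suc j) ja))) (in-block j jb)
        H-Aa : H (act (letter a))
        H-Aa = H-cancelˡ (H-before-a i ia) (subst H (act-next i ia) (H-cancelʳ H-τ (in-block (suc i) ib)))

  -- Two adjacent a's put the vector of a into H. The letter after some ab is either b, which gives
  -- bb, or a, and then aba puts the vector of b into H.
  from-aa : ∀ n → w n ≡ a → w (suc n) ≡ a → ∀ v → H v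
  from-aa n e e′ = after a-b
    where
    H-a : H (letter a)
    H-a = H-cancelˡ (H-vec n e refl) (H-vec (suc n) e′ (next-vec n e))
    after : ∃[ n ] (w n ≡ a × w (suc n) ≡ b) → ∀ v → H v
    after (i , ia , ib) with binary b≢a (w (suc (suc i)))
    ... | inj₂ ib′ = from-bb (suc i) ib ib′
    ... | inj₁ ia′ = H-all H-a (H-cancelˡ (H-⊕ (H-vec i ia refl) H-a)
            (H-vec (suc (suc i)) ia′ (trans (next-vec (suc i) ib) (cong (_⊕ letter b) (next-vec i ia)))))

  H-full : ∀ v → H v
  H-full = case (repetition abs≡1)
    where
    case : ∃[ i ] w i ≡ w (suc i) → ∀ v → H v
    case (i , e) with binary b≢a (w i)
    ... | inj₁ ea = from-aa i ea (trans (sym e) ea)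
    ... | inj₂ eb = from-bb i eb (trans (sym e) eb)

  -- Choose u with A^j u = v - V_i for j = i + n, and by `H-full` an a at q with V_q congruent to u.
  -- The copy of the prefix at `Bⁿ j q` is long enough to contain the factor, i letters further on.
  occurrence : ∀ i n v → ∃[ p ] (OccursAt w i n p × vec w p ≈ v)
  occurrence i n v = place (actⁿ-surjective (i ℕ.+ n) (v ⊕ - 1ℤ ⊙ vec w i))
    where
    j = i ℕ.+ n
    undo : ∀ x y → (x + - 1ℤ * y) + y ≡ x
    undo = solve-∀
    place : ∃[ u ] actⁿ j u ≡ v ⊕ - 1ℤ ⊙ vec w i → ∃[ p ] (OccursAt w i n p × vec w p ≈ v)
    place (u , eu) with H-full u
    ... | q , eq , pq = Bⁿ j q ℕ.+ i ,
      (λ r r<n → trans (cong w (ℕ.+-assoc (Bⁿ j q) i r)) (proj₁ (lift-occurs j eq (i ℕ.+ r) (ℕ.+-monoʳ-≤ i (ℕ.<⇒≤ r<n))))) ,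
      ≈-trans (≈-reflexive (proj₂ (lift-occurs j eq i (ℕ.m≤m+n i n))))
        (≈-trans (⊕-cong (≈-trans (actⁿ-cong j pq) (≈-reflexive eu)) ≈-refl)
          (≈-reflexive (cong₂ _,_ (undo (proj₁ v) (count l0 w i)) (undo (proj₂ v) (count l1 w i)))))

-- From the stated hypotheses to the equivalence.

generated⇒long : ∀ φ w → GeneratedBy φ w → 2 ≤ length (φ (w 0))
generated⇒long φ w (a , s , eq , s≢[] , pre) = subst (2 ≤_) (sym (trans (cong (length ∘ φ) (sym (pre 0 0 (s≤s z≤n)))) (cong length eq)))
  (s≤s (length-nonempty s≢[]))

other-letter : ∀ {w} → ContainsBoth w → ∃[ i ] w i ≢ w 0
other-letter {w} ((i , e₀) , (j , e₁)) with w 0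
... | zero     = j , λ e → case trans (sym e₁) e of λ ()
... | suc zero = i , λ e → case trans (sym e₀) e of λ ()

-- The determinant enters through its absolute value and its square, so one argument serves both
-- signs.
unimodular⇒welldoc : ∀ φ w → Nonerasing φ → GeneratedBy φ w → Recurrent w → ContainsBoth w →
                     ℤ.∣ detA φ ∣ ≡ 1 → detA φ * detA φ ≡ 1ℤ → WELLDOC w
unimodular⇒welldoc φ w ne gen rec both abs≡1 square≡1 k i n x₀ x₁ x₀< x₁< = convert (occurrence i n (+ x₀ , + x₁))
  where
  other = other-letter {w} both
  open Sufficiency φ w ne (generated⇒fixed φ w ne gen) rec (generated⇒long φ w gen)
                   (proj₁ other) (proj₂ other) abs≡1 square≡1 k
  open Congruence k
  convert : ∃[ p ] (OccursAt w i n p × vec w p ≈ (+ x₀ , + x₁)) →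
            ∃[ p ] (OccursAt w i n p × countPrefix l0 w p % suc k ≡ x₀ × countPrefix l1 w p % suc k ≡ x₁)
  convert (p , occ , congruent ∣₀ ∣₁) = p , occ , ∣⇒%≡ k _ x₀< ∣₀ , ∣⇒%≡ k _ x₁< ∣₁

theorem1 : (φ : Morphism) (w : InfWord) → Nonerasing φ → GeneratedBy φ w →
    Recurrent w → ContainsBoth w →
    (WELLDOC w ⇔ (detA φ ≡ + 1 ⊎ detA φ ≡ - (+ 1)))
theorem1 φ w ne gen rec both = mk⇔
  (welldoc⇒unimodular φ w ne (generated⇒fixed φ w ne gen) rec)
  λ where
    (inj₁ e) → unimodular⇒welldoc φ w ne gen rec both (cong ℤ.∣_∣ e) (cong (λ d → d * d) e)
    (inj₂ e) → unimodular⇒welldoc φ w ne gen rec both (cong ℤ.∣_∣ e) (cong (λ d → d * d) e)
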